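{- Let $\pi$ be a noncrossing perfect matching of $\{1,\ldots,2n\}$ and let $p$ be an integer with $1\le p\le n-1$. Then $m^{(A)}_p(\pi)=m^{(B)}_p(\pi)$.
   Context: A matching of size $n$ is a set of $n$ disjoint pairs $\{i,j\}$ (arches) whose union is $\{1,\ldots,2n\}$, noncrossing: there are no two arches $\{i<j\}$, $\{k<l\}$ with $i<k<j<l$. Write $\widehat{x}=2n+1-x$. Rule A: for $1\le p\le n-1$, let $\mathcal{A}_p^L(\pi)$ be the set of arches $\{a_1<a_2\}$ with $a_1\le p$ and $p<a_2<\widehat{p}$, and $\mathcal{A}_p^R(\pi)$ the set of arches $\{a_1<a_2\}$ with $p<a_1<\widehat{p}$ and $\widehat{p}\le a_2$. Set $m^{(A)}_p(\pi)=\frac{1}{2}\left(|\mathcal{A}_p^L(\pi)|+|\mathcal{A}_p^R(\pi)|\right)$ (this sum is always even). Young diagram: let $a_1<\cdots<a_n$ be the elements of $\{1,\ldots,2n\}$ that are the smaller elements of their arches. The Young diagram $Y(\pi)$ has rows (from top to bottom) of lengths $a_n-n\ge a_{n-1}-(n-1)\ge\cdots\ge a_1-1$ (English convention, left-justified). The box in row $x$ from the top and column $y$ from the left is denoted $(x,y)$. Rule B: label the box $(x,y)$ of $Y(\pi)$ by $n+1-x-y$. The rim of a Young diagram is the set of its boxes $(x,y)$ such that $(x+1,y+1)$ is not in the diagram; removing the rim leaves a Young diagram, and repeating until the diagram is empty decomposes $Y(\pi)$ into successive rims $R_1,\ldots,R_s$. For a rim $R_\ell$, let $i$ be the label of its bottom-left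 end box (lowest row, leftmost), $j$ the label of its top-right end box (top row, rightmost), and $k$ the minimal label in $R_\ell$. Let $B_\ell$ be the multiset $\{k\}\cup\{i,i-1,\ldots,k+1\}\cup\{j,j-1,\ldots,k+1\}$, and $B_\pi$ the multiset union of all $B_\ell$. Then $m^{(B)}_p(\pi)$ is the multiplicity of $p$ in $B_\pi$. -}

module Defs where

open import Data.Bool using (Bool; true; false; _∧_; _∨_; not; if_then_else_)
open import Data.Nat as ℕ using (ℕ; zero; suc; _+_; _*_; _∸_; _<_; _≤_; _≤ᵇ_; _<ᵇ_; _≡ᵇ_; _⊔_; _⊓_; ⌊_/2⌋)
open import Data.Integer as ℤ using (ℤ; +_)
open import Data.Product using (_×_; _,_; proj₁; proj₂)
open import Data.List using (List; []; _∷_; _++_; map; filterᵇ; concatMap; upTo; length; reverse; zipWith; foldr; null)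
open import Data.Bool.ListAction using (any)
open import Data.List.Relation.Unary.All using (All)
open import Data.List.Membership.Propositional using (_∈_)
open import Data.List.Relation.Binary.Permutation.Propositional using (_↭_)
open import Relation.Nullary using (¬_)

-- An arch {i < j} is stored as the ordered pair (i , j).
Arch : Set
Arch = ℕ × ℕ

endpoints : List Arch → List ℕ
endpoints = concatMap (λ a → proj₁ a ∷ proj₂ a ∷ [])

range1 : ℕ → List ℕ
range1 m = map suc (upTo m)

record IsNCMatching (n : ℕ) (π : List Arch) : Set where
  field
    ordered    : All (λ a → proj₁ a < proj₂ a) π
    perfect    : endpoints π ↭ range1 (2 * n)
    noncrossing : ∀ {i j k l} → (i , j) ∈ π → (k , l) ∈ π →
                  ¬ (i < k × k < j × j < l)

hat : ℕ → ℕ → ℕ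
hat n x = (2 * n + 1) ∸ x

ALset : ℕ → List Arch → ℕ → List Arch
ALset n π p = filterᵇ (λ a → (proj₁ a ≤ᵇ p) ∧ (p <ᵇ proj₂ a) ∧ (proj₂ a <ᵇ hat n p)) π

ARset : ℕ → List Arch → ℕ → List Arch
ARset n π p = filterᵇ (λ a → (p <ᵇ proj₁ a) ∧ (proj₁ a <ᵇ hat n p) ∧ (hat n p ≤ᵇ proj₂ a)) π

-- (|A^L_p| + |A^R_p|) / 2  (the sum is even, so floor-halving is exact)
mA : ℕ → List Arch → ℕ → ℕ
mA n π p = ⌊ length (ALset n π p) + length (ARset n π p) /2⌋

openers : ℕ → List Arch → List ℕ
openers n π = filterᵇ (λ x → any (λ a → proj₁ a ≡ᵇ x) π) (range1 (2 * n))

rowLengths : ℕ → List Arch → List ℕ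
rowLengths n π = reverse (zipWith _∸_ (openers n π) (range1 n))

Box : Set
Box = ℕ × ℕ

-- boxes (x , y), 1-indexed, row x from top, column y from left
boxesFrom : ℕ → List ℕ → List Box
boxesFrom x []       = []
boxesFrom x (r ∷ rs) = map (λ y → (x , y)) (range1 r) ++ boxesFrom (suc x) rs

Y : ℕ → List Arch → List Box
Y n π = boxesFrom 1 (rowLengths n π)

_∈ᵇ_ : Box → List Box → Bool
b ∈ᵇ D = any (λ c → (proj₁ b ≡ᵇ proj₁ c) ∧ (proj₂ b ≡ᵇ proj₂ c)) D

rim : List Box → List Box
rim D = filterᵇ (λ b → not ((suc (proj₁ b) , suc (proj₂ b)) ∈ᵇ D)) D

removeRim : List Box → List Box
removeRim D = filterᵇ (λ b → (suc (proj₁ b) , suc (proj₂ b)) ∈ᵇ D) D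

-- successive rims R₁, R₂, ... (fuel bounds the number of steps; each
-- step removes at least one box, so fuel = number of boxes suffices)
rimsFuel : ℕ → List Box → List (List Box)
rimsFuel zero    D = []
rimsFuel (suc f) D = if null D then [] else rim D ∷ rimsFuel f (removeRim D)

rims : List Box → List (List Box)
rims D = rimsFuel (length D) D

label : ℕ → Box → ℤ
label n b = (+ (n + 1)) ℤ.- (+ proj₁ b) ℤ.- (+ proj₂ b)

maxL : List ℕ → ℕ
maxL = foldr _⊔_ 0

minL : List ℕ → ℕ
minL []       = 0
minL (x ∷ xs) = foldr _⊓_ x xs

minZ : List ℤ → ℤ
minZ []       = + 0
minZ (x ∷ xs) = foldr ℤ._⊓_ x xs

bottomLeft : List Box → Box
bottomLeft R = let xb = maxL (map proj₁ R) in
  (xb , minL (map proj₂ (filterᵇ (λ b → proj₁ b ≡ᵇ xb) R)))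

topRight : List Box → Box
topRight R = let xt = minL (map proj₁ R) in
  (xt , maxL (map proj₂ (filterᵇ (λ b → proj₁ b ≡ᵇ xt) R)))

downTo : ℤ → ℤ → List ℤ
downTo i k = map (λ t → k ℤ.+ (+ suc t)) (upTo ℤ.∣ (i ℤ.- k) ℤ.⊔ (+ 0) ∣)

Bset : ℕ → List Box → List ℤ
Bset n R = let i = label n (bottomLeft R)
               j = label n (topRight R)
               k = minZ (map (label n) R)
           in k ∷ (downTo i k ++ downTo j k)

Bπ : ℕ → List Arch → List ℤ
Bπ n π = concatMap (Bset n) (rims (Y n π))

mB : ℕ → List Arch → ℕ → ℕ
mB n π p = length (filterᵇ (λ z → ℤ.∣ z ℤ.- (+ p) ∣ ≡ᵇ 0) (Bπ n π))

{-# OPTIONS --safe #-}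
module Submission where

-- Read π as a Dyck path with h q arches open after q steps. Put r = 2n − p, let d be the number of arches
-- closed by p, e the number opened after r, and M the number opened by p and closed after r. The two sets of
-- Rule A have sizes h p − M and h r − M, where h p = p − 2d and h r = p − 2e, so Rule A gives p − M − d − e.
--
-- A box of Y(π) is a closer preceding an opener. The rim left after removing ℓ rims meets the diagonal of q
-- in a box labelled h q + 2ℓ + 1, provided more than ℓ arches are closed by q and more than ℓ opened after q.
-- With i, j and k its corner labels and its minimal label, p ≤ i iff d ≤ ℓ, and p ≤ j iff e ≤ ℓ. Noncrossing
-- makes M the minimum of h on [p, r], which yields: if d ≤ ℓ then k ≤ p iff 2ℓ + 1 ≤ p − M, and if e ≤ ℓ then
-- k < p iff 2ℓ + 2 ≤ p − M. The rim contributes [k ≤ p ≤ i] + [k < p ≤ j], and summing over ℓ gives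
-- (⌈(p − M)/2⌉ − d) + (⌊(p − M)/2⌋ − e), the value of Rule A.

open import Defs
open import Data.Bool using (Bool; true; false; T; _∧_; not; if_then_else_)
open import Data.Bool.ListAction using (any)
open import Data.Bool.Properties using (T-≡; T-∧; ∧-zeroʳ; ∧-identityʳ)
open import Data.Integer as ℤ using (ℤ; _⊖_)
import Data.Integer.Properties as ℤ
open import Data.Empty using (⊥-elim)
open import Data.Unit using (tt)
open import Data.Nat
open import Data.Nat.Properties
open import Data.Nat.Tactic.RingSolver using (solve)
open import Data.Product using (_×_; _,_; proj₁; proj₂; ∃-syntax)
open import Data.Sum as Sum using (_⊎_; inj₁; inj₂; [_,_]′)
open import Data.List hiding (find; any)
open import Data.List.Properties
open import Data.List.Membership.Propositional using (_∈_; find; lose)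
open import Data.List.Membership.Propositional.Properties
open import Data.List.Membership.Propositional.Properties.WithK using (unique∧set⇒bag)
open import Data.List.Relation.Binary.BagAndSetEquality using (∼bag⇒↭)
open import Data.List.Relation.Binary.Permutation.Propositional using (_↭_; ↭⇒↭ₛ; ↭-sym)
open import Data.List.Relation.Binary.Permutation.Propositional.Properties using (filter-↭; ↭-length; ∈-resp-↭)
import Data.List.Relation.Binary.Permutation.Setoid.Properties as Permutationₛ
open import Data.List.Relation.Unary.All as All using (All)
open import Data.List.Relation.Unary.AllPairs as AllPairs using (AllPairs)
import Data.List.Relation.Unary.AllPairs.Properties as AllPairs
open import Data.List.Relation.Unary.Any as Any using (here; there; any?)
open import Data.List.Relation.Unary.Any.Properties using (any⁺; any⁻)
open import Data.List.Relation.Unary.Unique.Propositional using (Unique)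
import Data.List.Relation.Unary.Unique.Propositional.Properties as Unique
open import Function using (_∘_; id; mk⇔; Equivalence)
open import Relation.Nullary using (¬_; yes; no; contradiction)
open import Relation.Nullary.Decidable using (T?; _×-dec_)
open import Relation.Binary.Definitions using (tri<; tri≈; tri>)
open import Relation.Binary.PropositionalEquality

private variable
  A B : Set

-- Boolean comparisons and counting in lists.

≤ᵇ-true : ∀ {m n} → m ≤ n → (m ≤ᵇ n) ≡ true
≤ᵇ-true = Equivalence.to T-≡ ∘ ≤⇒≤ᵇ

≤ᵇ-false : ∀ {m n} → n < m → (m ≤ᵇ n) ≡ false
≤ᵇ-false {m} {n} n<m with m ≤ᵇ n in eq
... | false = refl
... | true  = contradiction (≤ᵇ⇒≤ m n (Equivalence.from T-≡ eq)) (<⇒≱ n<m)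

≡ᵇ-true : ∀ {m n} → m ≡ n → (m ≡ᵇ n) ≡ true
≡ᵇ-true {m} {n} = Equivalence.to T-≡ ∘ ≡⇒≡ᵇ m n

≡ᵇ-false : ∀ {m n} → m ≢ n → (m ≡ᵇ n) ≡ false
≡ᵇ-false {m} {n} m≢n with m ≡ᵇ n in eq
... | false = refl
... | true  = contradiction (≡ᵇ⇒≡ m n (Equivalence.from T-≡ eq)) m≢n

ind : Bool → ℕ
ind b = if b then 1 else 0

count : (A → Bool) → List A → ℕ
count f xs = length (filterᵇ f xs)

module _ (f : A → Bool) where

  count-∷ : ∀ x xs → count f (x ∷ xs) ≡ ind (f x) + count f xs
  count-∷ x xs with f x
  ... | true  = refl
  ... | false = refl

  count-++ : ∀ xs ys → count f (xs ++ ys) ≡ count f xs + count f ys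
  count-++ xs ys = trans (cong length (filter-++ (T? ∘ f) xs ys)) (length-++ (filterᵇ f xs))

  count-↭ : ∀ {xs ys} → xs ↭ ys → count f xs ≡ count f ys
  count-↭ = ↭-length ∘ filter-↭ (T? ∘ f)

count-map : (f : B → Bool) (g : A → B) → ∀ xs → count f (map g xs) ≡ count (f ∘ g) xs
count-map f g []       = refl
count-map f g (x ∷ xs) = begin
  count f (g x ∷ map g xs)           ≡⟨ count-∷ f (g x) (map g xs) ⟩
  ind (f (g x)) + count f (map g xs) ≡⟨ cong (ind (f (g x)) +_) (count-map f g xs) ⟩
  ind (f (g x)) + count (f ∘ g) xs   ≡⟨ count-∷ (f ∘ g) x xs ⟨
  count (f ∘ g) (x ∷ xs)             ∎
  where open ≡-Reasoning

-- The hypothesis is asked only of members of `xs`, so that an identity between indicators may use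
-- that the arches of a matching are ordered.
count-add : (f g h : A → Bool) → ∀ xs →
            (∀ {x} → x ∈ xs → ind (f x) + ind (g x) ≡ ind (h x)) →
            count f xs + count g xs ≡ count h xs
count-add f g h []       eq = refl
count-add f g h (x ∷ xs) eq = begin
  count f (x ∷ xs) + count g (x ∷ xs)
    ≡⟨ cong₂ _+_ (count-∷ f x xs) (count-∷ g x xs) ⟩
  (ind (f x) + count f xs) + (ind (g x) + count g xs)
    ≡⟨ shuffle (ind (f x)) (count f xs) (ind (g x)) (count g xs) ⟩
  (ind (f x) + ind (g x)) + (count f xs + count g xs)
    ≡⟨ cong₂ _+_ (eq (here refl)) (count-add f g h xs (eq ∘ there)) ⟩
  ind (h x) + count h xs
    ≡⟨ count-∷ h x xs ⟨
  count h (x ∷ xs) ∎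
  where
  open ≡-Reasoning
  shuffle : ∀ a b c d → (a + b) + (c + d) ≡ (a + c) + (b + d)
  shuffle a b c d = solve (a ∷ b ∷ c ∷ d ∷ [])

ind-mono : ∀ {a b} → (T a → T b) → ind a ≤ ind b
ind-mono {false}        imp = z≤n
ind-mono {true} {true}  imp = ≤-refl
ind-mono {true} {false} imp = ⊥-elim (imp tt)

count-mono : (f g : A → Bool) → ∀ xs → (∀ {x} → x ∈ xs → T (f x) → T (g x)) →
             count f xs ≤ count g xs
count-mono f g []       imp = z≤n
count-mono f g (x ∷ xs) imp = begin
  count f (x ∷ xs)       ≡⟨ count-∷ f x xs ⟩
  ind (f x) + count f xs ≤⟨ +-mono-≤ (ind-mono (imp (here refl))) (count-mono f g xs (imp ∘ there)) ⟩
  ind (g x) + count g xs ≡⟨ count-∷ g x xs ⟨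
  count g (x ∷ xs)       ∎
  where open ≤-Reasoning

count-≤-length : (f : A → Bool) → ∀ xs → count f xs ≤ length xs
count-≤-length f = length-filter (T? ∘ f)

count-upTo-suc : (f : ℕ → Bool) → ∀ m → count f (upTo (suc m)) ≡ count f (upTo m) + ind (f m)
count-upTo-suc f m = begin
  count f (upTo (suc m))                 ≡⟨ cong (count f) (upTo-∷ʳ m) ⟨
  count f (upTo m ∷ʳ m)                  ≡⟨ count-++ f (upTo m) (m ∷ []) ⟩
  count f (upTo m) + count f (m ∷ [])    ≡⟨ cong (count f (upTo m) +_) (trans (count-∷ f m []) (+-identityʳ _)) ⟩
  count f (upTo m) + ind (f m)           ∎
  where open ≡-Reasoning

-- Initial segments, list entries and increasing lists.

count-≤-range1 : ∀ q m → count (_≤ᵇ q) (range1 m) ≡ m ⊓ q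
count-≤-range1 q m = trans (count-map (_≤ᵇ q) suc (upTo m)) (go m)
  where
  go : ∀ m → count (λ t → suc t ≤ᵇ q) (upTo m) ≡ m ⊓ q
  go zero    = refl
  go (suc m) rewrite count-upTo-suc (λ t → suc t ≤ᵇ q) m | go m with ≤-<-connex (suc m) q
  ... | inj₁ m<q rewrite ≤ᵇ-true m<q | m≤n⇒m⊓n≡m (<⇒≤ m<q) | m≤n⇒m⊓n≡m m<q = +-comm m 1
  ... | inj₂ q≤m rewrite ≤ᵇ-false q≤m | m≥n⇒m⊓n≡n (s≤s⁻¹ q≤m) | m≥n⇒m⊓n≡n (<⇒≤ q≤m) = +-identityʳ q

∈-range1⁻ : ∀ {m x} → x ∈ range1 m → 1 ≤ x × x ≤ m
∈-range1⁻ x∈ with ∈-map⁻ suc x∈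
... | t , t∈ , refl = s≤s z≤n , ∈-upTo⁻ t∈

∈-range1⁺ : ∀ {m x} → 1 ≤ x → x ≤ m → x ∈ range1 m
∈-range1⁺ {x = suc x} _ x<m = ∈-map⁺ suc (∈-upTo⁺ x<m)

range1-increasing : ∀ m → AllPairs _<_ (range1 m)
range1-increasing m = AllPairs.map⁺ (AllPairs.applyUpTo⁺₁ id m (λ i<j _ → s≤s i<j))

length-range1 : ∀ m → length (range1 m) ≡ m
length-range1 m = trans (length-map suc (upTo m)) (length-upTo m)

-- Entry t of a list, counting from 0, with junk value 0 past the end.
nth : List ℕ → ℕ → ℕ
nth []       _       = 0
nth (x ∷ xs) zero    = x
nth (x ∷ xs) (suc t) = nth xs t

nth-++ˡ : ∀ xs ys {t} → t < length xs → nth (xs ++ ys) t ≡ nth xs t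
nth-++ˡ (x ∷ xs) ys {zero}  _         = refl
nth-++ˡ (x ∷ xs) ys {suc t} (s≤s t<l) = nth-++ˡ xs ys t<l

nth-∷ʳ : ∀ xs y → nth (xs ∷ʳ y) (length xs) ≡ y
nth-∷ʳ []       y = refl
nth-∷ʳ (x ∷ xs) y = nth-∷ʳ xs y

nth-end : ∀ xs {t} → length xs ≤ t → nth xs t ≡ 0
nth-end []       _         = refl
nth-end (x ∷ xs) (s≤s l≤t) = nth-end xs l≤t

nth-reverse : ∀ xs t m → suc m + t ≡ length xs → nth (reverse xs) t ≡ nth xs m
nth-reverse (x ∷ xs) t zero eq rewrite unfold-reverse x xs =
  subst (λ s → nth (reverse xs ∷ʳ x) s ≡ x)
    (trans (length-reverse xs) (sym (suc-injective eq))) (nth-∷ʳ (reverse xs) x)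
nth-reverse (x ∷ xs) t (suc m) eq rewrite unfold-reverse x xs =
  trans (nth-++ˡ (reverse xs) (x ∷ [])
          (subst (t <_) (sym (length-reverse xs)) (subst (t <_) (suc-injective eq) (s≤s (m≤n+m t m)))))
        (nth-reverse xs t m (suc-injective eq))

nth-zipWith-∸ : ∀ xs ys t → length xs ≡ length ys →
                nth (zipWith _∸_ xs ys) t ≡ nth xs t ∸ nth ys t
nth-zipWith-∸ []       []       t       eq = refl
nth-zipWith-∸ (x ∷ xs) (y ∷ ys) zero    eq = refl
nth-zipWith-∸ (x ∷ xs) (y ∷ ys) (suc t) eq = nth-zipWith-∸ xs ys t (suc-injective eq)

nth-range1 : ∀ {m t} → t < m → nth (range1 m) t ≡ suc t
nth-range1 {m} t<m = go id t<m
  where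
  go : ∀ (f : ℕ → ℕ) {m t} → t < m → nth (map suc (applyUpTo f m)) t ≡ suc (f t)
  go f {suc m} {zero}  _         = refl
  go f {suc m} {suc t} (s≤s t<m) = go (f ∘ suc) t<m

count-≤-none : ∀ {v} xs → All (v <_) xs → count (_≤ᵇ v) xs ≡ 0
count-≤-none []       _             = refl
count-≤-none {v} (x ∷ xs) (v<x All.∷ v<) rewrite count-∷ (_≤ᵇ v) x xs | ≤ᵇ-false v<x = count-≤-none xs v<

-- If entry `t` exceeds `v`, so do all later ones, and only the `t` entries before it can be
-- counted. With its converse, this turns positions of openers, which define the rows, into the
-- counts `opened`.
nth-increasing⁺ : ∀ {xs t v} → AllPairs _<_ xs → t < length xs → v < nth xs t → count (_≤ᵇ v) xs ≤ t
nth-increasing⁺ {x ∷ xs} {zero} (x< AllPairs.∷ _) _ v<x =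
  ≤-reflexive (count-≤-none (x ∷ xs) (v<x All.∷ All.map (<-trans v<x) x<))
nth-increasing⁺ {x ∷ xs} {suc t} {v} (_ AllPairs.∷ inc) (s≤s t<l) v<nth =
  subst (_≤ suc t) (sym (count-∷ (_≤ᵇ v) x xs))
    (+-mono-≤ (ind≤1 (x ≤ᵇ v)) (nth-increasing⁺ inc t<l v<nth))
  where
  ind≤1 : ∀ b → ind b ≤ 1
  ind≤1 false = z≤n
  ind≤1 true  = ≤-refl

nth-increasing⁻ : ∀ {xs t v} → AllPairs _<_ xs → t < length xs → count (_≤ᵇ v) xs ≤ t → v < nth xs t
nth-increasing⁻ {x ∷ xs} {t} {v} (x< AllPairs.∷ inc) t<l c≤t with ≤-<-connex x v
nth-increasing⁻ {x ∷ xs} {zero} {v} (x< AllPairs.∷ inc) t<l c≤t | inj₁ x≤v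
  rewrite count-∷ (_≤ᵇ v) x xs | ≤ᵇ-true x≤v with () ← c≤t
nth-increasing⁻ {x ∷ xs} {suc t} {v} (x< AllPairs.∷ inc) (s≤s t<l) c≤t | inj₁ x≤v
  rewrite count-∷ (_≤ᵇ v) x xs | ≤ᵇ-true x≤v = nth-increasing⁻ inc t<l (s≤s⁻¹ c≤t)
nth-increasing⁻ {x ∷ xs} {zero}  {v} (x< AllPairs.∷ inc) t<l       c≤t | inj₂ v<x = v<x
nth-increasing⁻ {x ∷ xs} {suc t} {v} (x< AllPairs.∷ inc) (s≤s t<l) c≤t | inj₂ v<x =
  nth-increasing⁻ inc t<l
    (subst (_≤ t) (sym (count-≤-none xs (All.map (<-trans v<x) x<))) z≤n)

-- Boxes of a diagram and arches spanning an interval.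

∈-boxesFrom⁻ : ∀ x₀ rs {x y} → (x , y) ∈ boxesFrom x₀ rs →
               ∃[ t ] x ≡ x₀ + t × 1 ≤ y × y ≤ nth rs t
∈-boxesFrom⁻ x₀ (r ∷ rs) b∈ with ∈-++⁻ (map (x₀ ,_) (range1 r)) b∈
... | inj₁ b∈row with ∈-map⁻ (x₀ ,_) b∈row
...   | y , y∈ , refl = 0 , sym (+-identityʳ x₀) , ∈-range1⁻ y∈
∈-boxesFrom⁻ x₀ (r ∷ rs) b∈ | inj₂ b∈rest with ∈-boxesFrom⁻ (suc x₀) rs b∈rest
... | t , x≡ , bounds = suc t , trans x≡ (sym (+-suc x₀ t)) , bounds

∈-boxesFrom⁺ : ∀ x₀ rs t {y} → 1 ≤ y → y ≤ nth rs t → (x₀ + t , y) ∈ boxesFrom x₀ rs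
∈-boxesFrom⁺ x₀ []       t       1≤y y≤ = contradiction (≤-trans 1≤y y≤) λ ()
∈-boxesFrom⁺ x₀ (r ∷ rs) zero    1≤y y≤ rewrite +-identityʳ x₀ =
  ∈-++⁺ˡ (∈-map⁺ (x₀ ,_) (∈-range1⁺ 1≤y y≤))
∈-boxesFrom⁺ x₀ (r ∷ rs) (suc t) 1≤y y≤ rewrite +-suc x₀ t =
  ∈-++⁺ʳ (map (x₀ ,_) (range1 r)) (∈-boxesFrom⁺ (suc x₀) rs t 1≤y y≤)

≤ᵇ-transˡ : ∀ m {q q′} → q ≤ q′ → T (m ≤ᵇ q) → T (m ≤ᵇ q′)
≤ᵇ-transˡ m q≤q′ t = ≤⇒≤ᵇ (≤-trans (≤ᵇ⇒≤ m _ t) q≤q′)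

spans : ℕ → ℕ → Arch → Bool
spans p r a = (proj₁ a ≤ᵇ p) ∧ (r <ᵇ proj₂ a)

spans⁻ : ∀ p r a → T (spans p r a) → proj₁ a ≤ p × r < proj₂ a
spans⁻ p r a t with Equivalence.to (T-∧ {proj₁ a ≤ᵇ p} {r <ᵇ proj₂ a}) t
... | t₁ , t₂ = ≤ᵇ⇒≤ (proj₁ a) p t₁ , <ᵇ⇒< r (proj₂ a) t₂

spans⁺ : ∀ p r a → proj₁ a ≤ p → r < proj₂ a → T (spans p r a)
spans⁺ p r a a₁≤p r<a₂ = Equivalence.from (T-∧ {proj₁ a ≤ᵇ p} {r <ᵇ proj₂ a}) (≤⇒≤ᵇ a₁≤p , <⇒<ᵇ r<a₂)

count-cong : {f g : A → Bool} → (∀ x → f x ≡ g x) → ∀ xs → count f xs ≡ count g xs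
count-cong         f≗g []       = refl
count-cong {f = f} {g} f≗g (x ∷ xs)
  rewrite count-∷ f x xs | count-∷ g x xs | f≗g x | count-cong {f = f} {g} f≗g xs = refl

-- Integer labels and the multiset of one rim.

-- Written exactly as the test in `mB`, so that `mB` unfolds to a `count` of it.
isℤ : ℕ → ℤ → Bool
isℤ p z = ℤ.∣ z ℤ.- (ℤ.+ p) ∣ ≡ᵇ 0

isℤ-+ : ∀ p a → isℤ p (ℤ.+ a) ≡ (a ≡ᵇ p)
isℤ-+ p a with a ≟ p
... | yes refl rewrite ℤ.+-inverseʳ (ℤ.+ a) | ≡ᵇ-true {a} refl = refl
... | no a≢p rewrite ≡ᵇ-false a≢p =
  ≡ᵇ-false (λ eq → a≢p (ℤ.+-injective (ℤ.i-j≡0⇒i≡j (ℤ.+ a) (ℤ.+ p) (ℤ.∣i∣≡0⇒i≡0 eq))))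

+-minus-+ : ∀ m n → ℤ.+ (m + n) ℤ.- ℤ.+ n ≡ ℤ.+ m
+-minus-+ m n = begin
  ℤ.+ (m + n) ℤ.- ℤ.+ n ≡⟨ ℤ.m-n≡m⊖n (m + n) n ⟩
  (m + n) ⊖ n       ≡⟨ ℤ.⊖-≥ (m≤n+m n m) ⟩
  ℤ.+ (m + n ∸ n)     ≡⟨ cong ℤ.+_ (m+n∸n≡m m n) ⟩
  ℤ.+ m               ∎
  where open ≡-Reasoning

-- The equation `v + (x + y) ≡ suc n` is how later statements say that a box has label `v`; it keeps
-- labels in ℕ and free of subtraction.
label-+ : ∀ {n v} x y → v + (x + y) ≡ suc n → label n (x , y) ≡ ℤ.+ v
label-+ {n} {v} x y eq = begin
  ℤ.+ (n + 1) ℤ.- ℤ.+ x ℤ.- ℤ.+ y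
    ≡⟨ cong (λ s → ℤ.+ s ℤ.- ℤ.+ x ℤ.- ℤ.+ y) (trans (+-comm n 1) (trans (sym eq) (shuffle v x y))) ⟩
  ℤ.+ (v + y + x) ℤ.- ℤ.+ x ℤ.- ℤ.+ y        ≡⟨ cong (λ z → z ℤ.- ℤ.+ y) (+-minus-+ (v + y) x) ⟩
  ℤ.+ (v + y) ℤ.- ℤ.+ y                    ≡⟨ +-minus-+ v y ⟩
  ℤ.+ v                                  ∎
  where
  open ≡-Reasoning
  shuffle : ∀ v x y → v + (x + y) ≡ v + y + x
  shuffle v x y = solve (v ∷ x ∷ y ∷ [])

within : ℕ → ℕ → ℕ → Bool
within k p i = (k <ᵇ p) ∧ (p ≤ᵇ i)

count-interval : ∀ k p m → count (λ t → (k + suc t) ≡ᵇ p) (upTo m) ≡ ind (within k p (k + m))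
count-interval k p zero with ≤-<-connex p (k + 0)
... | inj₁ p≤k rewrite ≤ᵇ-false {suc k} {p} (s≤s (subst (p ≤_) (+-identityʳ k) p≤k)) = refl
... | inj₂ k<p rewrite ≤ᵇ-false k<p | ∧-zeroʳ (k <ᵇ p) = refl
count-interval k p (suc m)
  rewrite count-upTo-suc (λ t → (k + suc t) ≡ᵇ p) m | count-interval k p m | +-suc k m
  with <-cmp p (suc (k + m))
... | tri< p<km p≢km _
  rewrite ≡ᵇ-false (p≢km ∘ sym) | ≤ᵇ-true (s≤s⁻¹ p<km) | ≤ᵇ-true (<⇒≤ p<km) = +-identityʳ _
... | tri≈ _ refl _
  rewrite ≡ᵇ-true {suc (k + m)} refl | ≤ᵇ-false {suc (k + m)} {k + m} ≤-refl
        | ≤ᵇ-true (s≤s (m≤m+n k m)) | ≤ᵇ-true (≤-refl {suc (k + m)}) = refl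
... | tri> _ km≢p km<p
  rewrite ≡ᵇ-false (km≢p ∘ sym) | ≤ᵇ-false km<p | ≤ᵇ-false (<-trans (n<1+n _) km<p)
        | ∧-zeroʳ (k <ᵇ p) = refl

count-downTo : ∀ p {i k} → k ≤ i → count (isℤ p) (downTo (ℤ.+ i) (ℤ.+ k)) ≡ ind (within k p i)
count-downTo p {i} {k} k≤i with m≤n⇒∃[o]m+o≡n k≤i
... | m , refl = begin
  count (isℤ p) (map (λ t → ℤ.+ (k + suc t)) (upTo ℤ.∣ (ℤ.+ (k + m) ℤ.- ℤ.+ k) ℤ.⊔ ℤ.+ 0 ∣))
    ≡⟨ cong (λ z → count (isℤ p) (map (λ t → ℤ.+ (k + suc t)) (upTo ℤ.∣ z ℤ.⊔ ℤ.+ 0 ∣)))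
         (trans (cong (λ s → ℤ.+ s ℤ.- ℤ.+ k) (+-comm k m)) (+-minus-+ m k)) ⟩
  count (isℤ p) (map (λ t → ℤ.+ (k + suc t)) (upTo (m ⊔ 0)))
    ≡⟨ cong (λ s → count (isℤ p) (map (λ t → ℤ.+ (k + suc t)) (upTo s))) (⊔-identityʳ m) ⟩
  count (isℤ p) (map (λ t → ℤ.+ (k + suc t)) (upTo m))
    ≡⟨ count-map (isℤ p) (λ t → ℤ.+ (k + suc t)) (upTo m) ⟩
  count (λ t → isℤ p (ℤ.+ (k + suc t))) (upTo m)
    ≡⟨ count-cong (λ t → isℤ-+ p (k + suc t)) (upTo m) ⟩
  count (λ t → (k + suc t) ≡ᵇ p) (upTo m)
    ≡⟨ count-interval k p m ⟩
  ind (within k p (k + m)) ∎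
  where open ≡-Reasoning

count-Bset : ∀ n R p {i j k} → label n (bottomLeft R) ≡ ℤ.+ i → label n (topRight R) ≡ ℤ.+ j →
             minZ (map (label n) R) ≡ ℤ.+ k → k ≤ i → k ≤ j →
             count (isℤ p) (Bset n R) ≡ ind (k ≡ᵇ p) + (ind (within k p i) + ind (within k p j))
count-Bset n R p {i} {j} {k} i≡ j≡ k≡ k≤i k≤j rewrite i≡ | j≡ | k≡ = begin
  count (isℤ p) (ℤ.+ k ∷ downTo (ℤ.+ i) (ℤ.+ k) ++ downTo (ℤ.+ j) (ℤ.+ k))
    ≡⟨ count-∷ (isℤ p) (ℤ.+ k) _ ⟩
  ind (isℤ p (ℤ.+ k)) + count (isℤ p) (downTo (ℤ.+ i) (ℤ.+ k) ++ downTo (ℤ.+ j) (ℤ.+ k))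
    ≡⟨ cong₂ _+_ (cong ind (isℤ-+ p k)) (count-++ (isℤ p) (downTo (ℤ.+ i) (ℤ.+ k)) (downTo (ℤ.+ j) (ℤ.+ k))) ⟩
  ind (k ≡ᵇ p) + (count (isℤ p) (downTo (ℤ.+ i) (ℤ.+ k)) + count (isℤ p) (downTo (ℤ.+ j) (ℤ.+ k)))
    ≡⟨ cong (λ s → ind (k ≡ᵇ p) + s) (cong₂ _+_ (count-downTo p k≤i) (count-downTo p k≤j)) ⟩
  ind (k ≡ᵇ p) + (ind (within k p i) + ind (within k p j)) ∎
  where open ≡-Reasoning

-- Extrema of lists, and rims as sets of boxes.

≤-maxL : ∀ {x xs} → x ∈ xs → x ≤ maxL xs
≤-maxL {x} {xs} x∈ = foldr-preservesᵒ
  (λ y z → [ m≤n⇒m≤n⊔o z , m≤n⇒m≤o⊔n y ]′) 0 xs (inj₂ (Any.map ≤-reflexive x∈))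

-- The fold may select its default 0, which need not be an entry; a positive entry rules this out.
maxL-∈ : ∀ {x xs} → x ∈ xs → 1 ≤ x → maxL xs ∈ xs
maxL-∈ {x} {xs} x∈ 1≤x with foldr-selective ⊔-sel 0 xs
... | inj₂ max∈ = max∈
... | inj₁ max≡0 = contradiction (≤-trans 1≤x (≤-trans (≤-maxL x∈) (≤-reflexive max≡0))) λ ()

maxL-unique : ∀ {x xs} → x ∈ xs → (∀ {y} → y ∈ xs → y ≤ x) → maxL xs ≡ x
maxL-unique x∈ ≤x = ≤-antisym (foldr-preservesᵇ ⊔-lub z≤n (All.tabulate ≤x)) (≤-maxL x∈)

minL-∈ : ∀ {x xs} → x ∈ xs → minL xs ∈ xs
minL-∈ {xs = y ∷ ys} _ with foldr-selective ⊓-sel y ys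
... | inj₁ min≡y = here min≡y
... | inj₂ min∈  = there min∈

minL-≤ : ∀ {x xs} → x ∈ xs → minL xs ≤ x
minL-≤ {x} {y ∷ ys} x∈ = foldr-preservesᵒ
  (λ u v → [ m≤n⇒m⊓o≤n v , m≤n⇒o⊓m≤n u ]′) y ys
  (Sum.map (≤-reflexive ∘ sym) (Any.map (≤-reflexive ∘ sym)) (Any.toSum x∈))

minL-unique : ∀ {x xs} → x ∈ xs → (∀ {y} → y ∈ xs → x ≤ y) → minL xs ≡ x
minL-unique x∈ x≤ = ≤-antisym (minL-≤ x∈) (x≤ (minL-∈ x∈))

minZ-∈ : ∀ {z zs} → z ∈ zs → minZ zs ∈ zs
minZ-∈ {zs = y ∷ ys} _ with foldr-selective ℤ.⊓-sel y ys
... | inj₁ min≡y = here min≡y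
... | inj₂ min∈  = there min∈

minZ-≤ : ∀ {z zs} → z ∈ zs → minZ zs ℤ.≤ z
minZ-≤ {z} {y ∷ ys} z∈ = foldr-preservesᵒ
  (λ u v → [ ℤ.i≤j⇒i⊓k≤j v , ℤ.i≤j⇒k⊓i≤j u ]′) y ys
  (Sum.map (ℤ.≤-reflexive ∘ sym) (Any.map (ℤ.≤-reflexive ∘ sym)) (Any.toSum z∈))

∈ᵇ⁻ : ∀ {b D} → T (b ∈ᵇ D) → b ∈ D
∈ᵇ⁻ {x , y} {D} t with find (any⁻ (λ c → (x ≡ᵇ proj₁ c) ∧ (y ≡ᵇ proj₂ c)) D t)
... | (x′ , y′) , c∈ , t′ with Equivalence.to (T-∧ {x ≡ᵇ x′} {y ≡ᵇ y′}) t′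
...   | x≡ , y≡ = subst (_∈ D) (sym (cong₂ _,_ (≡ᵇ⇒≡ x x′ x≡) (≡ᵇ⇒≡ y y′ y≡))) c∈

∈ᵇ⁺ : ∀ {b D} → b ∈ D → T (b ∈ᵇ D)
∈ᵇ⁺ {x , y} b∈ = any⁺ (λ c → (x ≡ᵇ proj₁ c) ∧ (y ≡ᵇ proj₂ c))
  (lose b∈ (Equivalence.from (T-∧ {x ≡ᵇ x} {y ≡ᵇ y}) (≡⇒≡ᵇ x x refl , ≡⇒≡ᵇ y y refl)))

T-not⁺ : ∀ {b} → ¬ T b → T (not b)
T-not⁺ {false} _  = tt
T-not⁺ {true}  ¬t = ¬t tt

T-not⁻ : ∀ {b} → T (not b) → ¬ T b
T-not⁻ {false} _ ()

next : Box → Box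
next (x , y) = suc x , suc y

∈-rim⁺ : ∀ {b} D → b ∈ D → ¬ (next b ∈ D) → b ∈ rim D
∈-rim⁺ D b∈ ¬next = ∈-filter⁺ (T? ∘ (λ b → not (next b ∈ᵇ D))) b∈ (T-not⁺ (¬next ∘ ∈ᵇ⁻))

∈-rim⁻ : ∀ {b} D → b ∈ rim D → b ∈ D × ¬ (next b ∈ D)
∈-rim⁻ D b∈ with ∈-filter⁻ (T? ∘ (λ b → not (next b ∈ᵇ D))) {xs = D} b∈
... | b∈D , t = b∈D , T-not⁻ t ∘ ∈ᵇ⁺

∈-removeRim⁺ : ∀ {b} D → b ∈ D → next b ∈ D → b ∈ removeRim D
∈-removeRim⁺ D b∈ next∈ = ∈-filter⁺ (T? ∘ (λ b → next b ∈ᵇ D)) b∈ (∈ᵇ⁺ next∈)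

∈-removeRim⁻ : ∀ {b} D → b ∈ removeRim D → b ∈ D × next b ∈ D
∈-removeRim⁻ D b∈ with ∈-filter⁻ (T? ∘ (λ b → next b ∈ᵇ D)) {xs = D} b∈
... | b∈D , t = b∈D , ∈ᵇ⁻ t

removeRim-shrinks : ∀ {b} D → b ∈ D → ¬ (next b ∈ D) → length (removeRim D) < length D
removeRim-shrinks D b∈ ¬next = filter-notAll (T? ∘ (λ b → next b ∈ᵇ D)) D (lose b∈ (¬next ∘ ∈ᵇ⁻))

-- Indicators of intervals, and halves.

ind-cong : ∀ {a b} → (T a → T b) → (T b → T a) → ind a ≡ ind b
ind-cong to from = ≤-antisym (ind-mono to) (ind-mono from)

within⁺ : ∀ k p i → k < p → p ≤ i → T (within k p i)
within⁺ k p i k<p p≤i = Equivalence.from (T-∧ {k <ᵇ p}) (<⇒<ᵇ k<p , ≤⇒≤ᵇ p≤i)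

within⁻ : ∀ k p i → T (within k p i) → k < p × p ≤ i
within⁻ k p i t with Equivalence.to (T-∧ {k <ᵇ p} {p ≤ᵇ i}) t
... | t₁ , t₂ = <ᵇ⇒< k p t₁ , ≤ᵇ⇒≤ p i t₂

-- Serves twice: for the label `p` between the minimum and a corner label, and for the index `ℓ` of
-- a rim that contributes.
between : ℕ → ℕ → ℕ → Bool
between c ℓ a = (c ≤ᵇ ℓ) ∧ (ℓ <ᵇ a)

between⁺ : ∀ c ℓ a → c ≤ ℓ → ℓ < a → T (between c ℓ a)
between⁺ c ℓ a c≤ℓ ℓ<a = Equivalence.from (T-∧ {c ≤ᵇ ℓ}) (≤⇒≤ᵇ c≤ℓ , <⇒<ᵇ ℓ<a)

between⁻ : ∀ c ℓ a → T (between c ℓ a) → c ≤ ℓ × ℓ < a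
between⁻ c ℓ a t with Equivalence.to (T-∧ {c ≤ᵇ ℓ} {ℓ <ᵇ a}) t
... | t₁ , t₂ = ≤ᵇ⇒≤ c ℓ t₁ , <ᵇ⇒< ℓ a t₂

-- The single `k` of the multiset is joined to the arm ending at `i`, which becomes closed at `k`,
-- while the arm ending at `j` stays open there. This asymmetry produces a ceiling in one term and a
-- floor in the other.
ind-≡-within : ∀ k p i → k ≤ i → ind (k ≡ᵇ p) + ind (within k p i) ≡ ind (between k p (suc i))
ind-≡-within k p i k≤i with <-cmp k p
... | tri< k<p k≢p _ rewrite ≡ᵇ-false k≢p | ≤ᵇ-true k<p | ≤ᵇ-true (<⇒≤ k<p) =
  ind-cong (<⇒<ᵇ ∘ s≤s ∘ ≤ᵇ⇒≤ p i) (≤⇒≤ᵇ ∘ s≤s⁻¹ ∘ <ᵇ⇒< p (suc i))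
... | tri≈ _ refl _ rewrite ≡ᵇ-true {k} refl | ≤ᵇ-false {suc k} {k} ≤-refl
                          | ≤ᵇ-true (≤-refl {k}) | ≤ᵇ-true (s≤s k≤i) = refl
... | tri> _ k≢p p<k rewrite ≡ᵇ-false k≢p | ≤ᵇ-false p<k | ≤ᵇ-false (<-trans p<k (n<1+n k)) = refl

-- The left side is the number of integers from `c ⊔ ℓ` up to `a`, with `a` excluded; raising `ℓ` by
-- one loses at most `ℓ` itself.
∸-step : ∀ a c ℓ → a ∸ (c ⊔ ℓ) ≡ ind (between c ℓ a) + (a ∸ (c ⊔ suc ℓ))
∸-step a c ℓ with ≤-<-connex c ℓ
... | inj₂ ℓ<c rewrite ≤ᵇ-false ℓ<c | m≥n⇒m⊔n≡m (<⇒≤ ℓ<c) | m≥n⇒m⊔n≡m ℓ<c = refl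
... | inj₁ c≤ℓ rewrite ≤ᵇ-true c≤ℓ | m≤n⇒m⊔n≡n c≤ℓ | m≤n⇒m⊔n≡n (m≤n⇒m≤1+n c≤ℓ) with ≤-<-connex a ℓ
...   | inj₁ a≤ℓ rewrite ≤ᵇ-false (s≤s a≤ℓ) | m≤n⇒m∸n≡0 a≤ℓ | m≤n⇒m∸n≡0 (m≤n⇒m≤1+n a≤ℓ) = refl
...   | inj₂ ℓ<a rewrite ≤ᵇ-true ℓ<a = +-∸-assoc 1 ℓ<a

<-⌈/2⌉⁻ : ∀ {ℓ} X → ℓ < ⌈ X /2⌉ → suc (ℓ + ℓ) ≤ X
<-⌈/2⌉⁻ {zero}  (suc X)       _       = s≤s z≤n
<-⌈/2⌉⁻ {suc ℓ} (suc (suc X)) (s≤s l) rewrite +-suc ℓ ℓ = s≤s (s≤s (<-⌈/2⌉⁻ X l))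

<-⌈/2⌉⁺ : ∀ {ℓ} X → suc (ℓ + ℓ) ≤ X → ℓ < ⌈ X /2⌉
<-⌈/2⌉⁺ {zero}  (suc X) _ = s≤s z≤n
<-⌈/2⌉⁺ {suc ℓ} (suc X) (s≤s l) rewrite +-suc ℓ ℓ with X | l
... | suc X′ | s≤s l′ = s≤s (<-⌈/2⌉⁺ X′ l′)

<-⌊/2⌋⁻ : ∀ {ℓ} X → ℓ < ⌊ X /2⌋ → suc (suc (ℓ + ℓ)) ≤ X
<-⌊/2⌋⁻ {zero}  (suc (suc X)) _       = s≤s (s≤s z≤n)
<-⌊/2⌋⁻ {suc ℓ} (suc (suc X)) (s≤s l) rewrite +-suc ℓ ℓ = s≤s (s≤s (<-⌊/2⌋⁻ X l))

<-⌊/2⌋⁺ : ∀ {ℓ} X → suc (suc (ℓ + ℓ)) ≤ X → ℓ < ⌊ X /2⌋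
<-⌊/2⌋⁺ {ℓ} (suc X) (s≤s l) = <-⌈/2⌉⁺ X l

<-half : ∀ {ℓ c} → suc (ℓ + ℓ) ≤ c + c → ℓ < c
<-half 2ℓ<2c = ≰⇒> λ c≤ℓ → <⇒≱ 2ℓ<2c (+-mono-≤ c≤ℓ c≤ℓ)

-- Counts along the Dyck path of a matching.

module Matching (n : ℕ) (π : List Arch) (nc : IsNCMatching n π) where

  open IsNCMatching nc

  opened closed : ℕ → ℕ
  opened q = count (λ a → proj₁ a ≤ᵇ q) π
  closed q = count (λ a → proj₂ a ≤ᵇ q) π

  spanning : ℕ → ℕ → ℕ
  spanning p r = count (spans p r) π

  height : ℕ → ℕ
  height q = spanning q q

  arch-ordered : ∀ {a} → a ∈ π → proj₁ a < proj₂ a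
  arch-ordered = All.lookup ordered

  count-endpoints : ∀ f σ → count f (endpoints σ) ≡ count (f ∘ proj₁) σ + count (f ∘ proj₂) σ
  count-endpoints f []      = refl
  count-endpoints f (a ∷ σ)
    rewrite count-∷ f (proj₁ a) (proj₂ a ∷ endpoints σ) | count-∷ f (proj₂ a) (endpoints σ)
          | count-∷ (f ∘ proj₁) a σ | count-∷ (f ∘ proj₂) a σ | count-endpoints f σ =
    shuffle (ind (f (proj₁ a))) (ind (f (proj₂ a))) (count (f ∘ proj₁) σ) (count (f ∘ proj₂) σ)
    where
    shuffle : ∀ a b c d → a + (b + (c + d)) ≡ (a + c) + (b + d)
    shuffle a b c d = solve (a ∷ b ∷ c ∷ d ∷ [])

  -- Each of the points 1 to `q` occurs exactly once among the endpoints, as an opener or as a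
  -- closer.
  opened+closed : ∀ {q} → q ≤ 2 * n → opened q + closed q ≡ q
  opened+closed {q} q≤2n = begin
    opened q + closed q                  ≡⟨ count-endpoints (_≤ᵇ q) π ⟨
    count (_≤ᵇ q) (endpoints π)          ≡⟨ count-↭ (_≤ᵇ q) perfect ⟩
    count (_≤ᵇ q) (range1 (2 * n))       ≡⟨ count-≤-range1 q (2 * n) ⟩
    2 * n ⊓ q                            ≡⟨ m≥n⇒m⊓n≡n q≤2n ⟩
    q                                    ∎
    where open ≡-Reasoning

  length-π : length π ≡ n
  length-π = *-cancelˡ-≡ (length π) n 2 (begin
    2 * length π              ≡⟨ length-endpoints π ⟨
    length (endpoints π)      ≡⟨ ↭-length perfect ⟩
    length (range1 (2 * n))   ≡⟨ length-range1 (2 * n) ⟩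
    2 * n                     ∎)
    where
    open ≡-Reasoning
    length-endpoints : ∀ σ → length (endpoints σ) ≡ 2 * length σ
    length-endpoints []      = refl
    length-endpoints (a ∷ σ) rewrite length-endpoints σ = cong suc (sym (+-suc (length σ) (length σ + 0)))

  opened≤n : ∀ q → opened q ≤ n
  opened≤n q = subst (opened q ≤_) length-π (count-≤-length _ π)

  closed≤n : ∀ q → closed q ≤ n
  closed≤n q = subst (closed q ≤_) length-π (count-≤-length _ π)

  opened-mono : ∀ {q q′} → q ≤ q′ → opened q ≤ opened q′
  opened-mono q≤q′ = count-mono _ _ π λ {a} _ → ≤ᵇ-transˡ (proj₁ a) q≤q′

  closed-mono : ∀ {q q′} → q ≤ q′ → closed q ≤ closed q′
  closed-mono q≤q′ = count-mono _ _ π λ {a} _ → ≤ᵇ-transˡ (proj₂ a) q≤q′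

  -- An arch opened by `q` is either still open or already closed, and an arch closed by `q` was
  -- opened by `q` because arches are ordered.
  height+closed : ∀ q → height q + closed q ≡ opened q
  height+closed q = count-add (spans q q) _ _ π pointwise
    where
    pointwise : ∀ {a} → a ∈ π →
      ind (spans q q a) + ind (proj₂ a ≤ᵇ q) ≡ ind (proj₁ a ≤ᵇ q)
    pointwise {a₁ , a₂} a∈ with ≤-<-connex a₂ q
    ... | inj₁ a₂≤q rewrite ≤ᵇ-true a₂≤q | ≤ᵇ-false (s≤s a₂≤q)
                          | ≤ᵇ-true (≤-trans (<⇒≤ (arch-ordered a∈)) a₂≤q) = refl
    ... | inj₂ q<a₂ rewrite ≤ᵇ-false q<a₂ | ≤ᵇ-true q<a₂ | ∧-identityʳ (a₁ ≤ᵇ q) = +-identityʳ _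

  spanning≤height : ∀ {p q r} → p ≤ q → q ≤ r → spanning p r ≤ height q
  spanning≤height {p} {q} {r} p≤q q≤r = count-mono (spans p r) (spans q q) π λ {a} _ t →
    let a₁≤p , r<a₂ = spans⁻ p r a t in
    spans⁺ q q a (≤-trans a₁≤p p≤q) (≤-<-trans q≤r r<a₂)

  -- Distinct endpoints and the minimum height.

  endpoints-unique : Unique (endpoints π)
  endpoints-unique = Permutationₛ.Unique-resp-↭ (setoid ℕ) (↭⇒↭ₛ (↭-sym perfect))
    (AllPairs.map <⇒≢ (range1-increasing (2 * n)))

  proj₁∈endpoints : ∀ {a} σ → a ∈ σ → proj₁ a ∈ endpoints σ
  proj₁∈endpoints (_ ∷ σ) (here refl) = here refl
  proj₁∈endpoints (_ ∷ σ) (there a∈)  = there (there (proj₁∈endpoints σ a∈))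

  proj₂∈endpoints : ∀ {a} σ → a ∈ σ → proj₂ a ∈ endpoints σ
  proj₂∈endpoints (_ ∷ σ) (here refl) = there (here refl)
  proj₂∈endpoints (_ ∷ σ) (there a∈)  = there (there (proj₂∈endpoints σ a∈))

  -- Needed to make an inequality between an opener and a closer strict before noncrossing is
  -- applied.
  closer≢opener : ∀ {a b} σ → Unique (endpoints σ) → a ∈ σ → b ∈ σ → proj₂ a ≢ proj₁ b
  closer≢opener (c ∷ σ) (c₁≢ AllPairs.∷ _) (here refl) (here refl) eq =
    All.lookup c₁≢ (here refl) (sym eq)
  closer≢opener (c ∷ σ) (_ AllPairs.∷ (c₂≢ AllPairs.∷ _)) (here refl) (there b∈) eq =
    All.lookup c₂≢ (proj₁∈endpoints σ b∈) eq
  closer≢opener (c ∷ σ) (c₁≢ AllPairs.∷ _) (there a∈) (here refl) eq =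
    All.lookup c₁≢ (there (proj₂∈endpoints σ a∈)) (sym eq)
  closer≢opener (c ∷ σ) (_ AllPairs.∷ (_ AllPairs.∷ uniq)) (there a∈) (there b∈) eq =
    closer≢opener σ uniq a∈ b∈ eq

  openers-unique : ∀ σ → Unique (endpoints σ) → Unique (map proj₁ σ)
  openers-unique []      _ = AllPairs.[]
  openers-unique (c ∷ σ) (c₁≢ AllPairs.∷ (_ AllPairs.∷ uniq)) =
    All.tabulate (λ x∈ → let b , b∈ , x≡ = ∈-map⁻ proj₁ x∈ in
                         All.lookup c₁≢ (there (subst (_∈ endpoints σ) (sym x≡) (proj₁∈endpoints σ b∈))))
    AllPairs.∷ openers-unique σ uniq

  -- The last point of [p, r] where an arch opened up to p closes, or p if there is none.
  lastReturn : ∀ {p} r → p ≤ r → ∃[ q ] p ≤ q × q ≤ r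
    × (∀ {a} → a ∈ π → proj₁ a ≤ p → q < proj₂ a → r < proj₂ a)
    × (q ≡ p ⊎ ∃[ b ] b ≤ p × (b , q) ∈ π)
  lastReturn {p} r p≤r with m≤n⇒m<n∨m≡n p≤r
  ... | inj₂ refl = p , ≤-refl , ≤-refl , (λ _ _ p<a₂ → p<a₂) , inj₁ refl
  lastReturn {p} (suc r) _ | inj₁ (s≤s p≤r)
    with any? (λ a → (proj₁ a ≤? p) ×-dec (proj₂ a ≟ suc r)) π
  ... | yes some with find some
  ...   | (b , .(suc r)) , b∈ , b≤p , refl =
    suc r , m≤n⇒m≤1+n p≤r , ≤-refl , (λ _ _ r<a₂ → r<a₂) , inj₂ (b , b≤p , b∈)
  lastReturn {p} (suc r) _ | inj₁ (s≤s p≤r) | no none with lastReturn r p≤r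
  ... | q , p≤q , q≤r , beyond , origin =
    q , p≤q , m≤n⇒m≤1+n q≤r ,
    -- The induction hypothesis gives `r < proj₂ a`, and `none` excludes closing at `suc r`.
    (λ a∈ a₁≤p q<a₂ → ≤∧≢⇒< (beyond a∈ a₁≤p q<a₂) (λ eq → none (lose a∈ (a₁≤p , sym eq)))) ,
    origin

  -- With `spanning≤height` this makes `spanning p r` the minimum height on [p, r]. At the last
  -- return `q` every open arch was opened by `p`, and such an arch, not closed by `q`, closes only
  -- after `r`.
  height-minimum : ∀ {p r} → p ≤ r → ∃[ q ] p ≤ q × q ≤ r × height q ≤ spanning p r
  height-minimum {p} {r} p≤r with lastReturn r p≤r
  ... | q , p≤q , q≤r , beyond , origin =
    q , p≤q , q≤r , count-mono (spans q q) (spans p r) π λ {a} a∈ t →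
      let a₁≤q , q<a₂ = spans⁻ q q a t
          a₁≤p        = opened-before a∈ a₁≤q q<a₂ origin
      in spans⁺ p r a a₁≤p (beyond a∈ a₁≤p q<a₂)
    where
    -- An arch opened in (p, q] and still open at q would cross the one closed by q.
    opened-before : ∀ {a} → a ∈ π → proj₁ a ≤ q → q < proj₂ a →
                    (q ≡ p ⊎ ∃[ b ] b ≤ p × (b , q) ∈ π) → proj₁ a ≤ p
    opened-before a∈ a₁≤q q<a₂ (inj₁ refl) = a₁≤q
    opened-before {a₁ , a₂} a∈ a₁≤q q<a₂ (inj₂ (b , b≤p , b∈)) with ≤-<-connex a₁ p
    ... | inj₁ a₁≤p = a₁≤p
    ... | inj₂ p<a₁ = ⊥-elim (noncrossing b∈ a∈
      (≤-<-trans b≤p p<a₁ , ≤∧≢⇒< a₁≤q (closer≢opener π endpoints-unique b∈ a∈ ∘ sym) , q<a₂))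

  -- The Young diagram through openers and closers.

  -- Both lists are free of repetitions and have the same members. Lengths and counts thus pass from
  -- the sorted openers to the arches.
  openers-↭ : openers n π ↭ map proj₁ π
  openers-↭ = ∼bag⇒↭ (unique∧set⇒bag
    (Unique.filter⁺ _ (AllPairs.map <⇒≢ (range1-increasing (2 * n))))
    (openers-unique π endpoints-unique)
    (mk⇔ to from))
    where
    to : ∀ {x} → x ∈ openers n π → x ∈ map proj₁ π
    to {x} x∈ =
      let _ , t       = ∈-filter⁻ (T? ∘ (λ x → any (λ a → proj₁ a ≡ᵇ x) π)) {xs = range1 (2 * n)} x∈
          a , a∈ , eq = find (any⁻ (λ a → proj₁ a ≡ᵇ x) π t)
      in subst (_∈ map proj₁ π) (≡ᵇ⇒≡ (proj₁ a) x eq) (∈-map⁺ proj₁ a∈)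

    from : ∀ {x} → x ∈ map proj₁ π → x ∈ openers n π
    from x∈ with ∈-map⁻ proj₁ x∈
    ... | a , a∈ , refl = ∈-filter⁺ (T? ∘ _) (∈-resp-↭ perfect (proj₁∈endpoints π a∈))
      (any⁺ _ (lose a∈ (≡⇒≡ᵇ (proj₁ a) (proj₁ a) refl)))

  length-openers : length (openers n π) ≡ n
  length-openers = trans (↭-length openers-↭) (trans (length-map proj₁ π) length-π)

  count-openers : ∀ q → count (_≤ᵇ q) (openers n π) ≡ opened q
  count-openers q = trans (count-↭ (_≤ᵇ q) openers-↭) (count-map (_≤ᵇ q) proj₁ π)

  openers-increasing : AllPairs _<_ (openers n π)
  openers-increasing = AllPairs.filter⁺ _ (range1-increasing (2 * n))

  -- Row x has as many boxes as there are closers before opener number m + 1, where m = n − x.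
  InY : Box → Set
  InY (x , y) = 1 ≤ x × 1 ≤ y × ∃[ m ] m + x ≡ n × y ≤ closed (m + y)

  length-rows : length (zipWith _∸_ (openers n π) (range1 n)) ≡ n
  length-rows = trans (length-zipWith _∸_ (openers n π) (range1 n))
    (trans (cong₂ _⊓_ length-openers (length-range1 n)) (⊓-idem n))

  length-rowLengths : length (rowLengths n π) ≡ n
  length-rowLengths = trans (length-reverse (zipWith _∸_ (openers n π) (range1 n))) length-rows

  rowLength : ∀ m t → suc m + t ≡ n → nth (rowLengths n π) t ≡ nth (openers n π) m ∸ suc m
  rowLength m t eq = begin
    nth (rowLengths n π) t                       ≡⟨ nth-reverse zs t m (trans eq (sym length-rows)) ⟩
    nth zs m
      ≡⟨ nth-zipWith-∸ (openers n π) (range1 n) m (trans length-openers (sym (length-range1 n))) ⟩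
    nth (openers n π) m ∸ nth (range1 n) m
      ≡⟨ cong (nth (openers n π) m ∸_) (nth-range1 (m+n≤o⇒m≤o (suc m) (≤-reflexive eq))) ⟩
    nth (openers n π) m ∸ suc m                  ∎
    where
    open ≡-Reasoning
    zs = zipWith _∸_ (openers n π) (range1 n)

  -- Places the point `m + y` on the path, so that `opened+closed` applies to it.
  diagonal≤2n : ∀ m {x} y → m + x ≡ n → y ≤ closed (m + y) → m + y ≤ 2 * n
  diagonal≤2n m y m+x y≤ = +-mono-≤ (m+n≤o⇒m≤o m (≤-reflexive m+x))
    (≤-trans y≤ (≤-trans (closed≤n (m + y)) (m≤m+n n 0)))

  opened-all : ∀ {q} → 2 * n ≤ q → n ≤ opened q
  opened-all {q} 2n≤q = ≤-trans (+-cancelʳ-≤ n n (opened (2 * n)) (begin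
    n + n                             ≡⟨ cong (n +_) (+-identityʳ n) ⟨
    2 * n                             ≡⟨ opened+closed ≤-refl ⟨
    opened (2 * n) + closed (2 * n)   ≤⟨ +-monoʳ-≤ (opened (2 * n)) (closed≤n (2 * n)) ⟩
    opened (2 * n) + n                ∎)) (opened-mono 2n≤q)
    where open ≤-Reasoning

  -- The row bound says that opener number `m + 1` comes after `m + y`. Hence at most `m` of the
  -- first `m + y` points are openers, and at least `y` are closers. `∈-Y⁺` runs the same chain
  -- backwards.
  ∈-Y⁻ : ∀ {b} → b ∈ Y n π → InY b
  ∈-Y⁻ {x , y} b∈ with ∈-boxesFrom⁻ 1 (rowLengths n π) b∈
  ... | t , refl , 1≤y , y≤row with ≤-<-connex n t
  -- Past the last row `nth` takes its junk value 0, which leaves no room for `y`.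
  ...   | inj₁ n≤t = contradiction
    (subst (1 ≤_) (nth-end (rowLengths n π) (subst (_≤ t) (sym length-rowLengths) n≤t)) (≤-trans 1≤y y≤row))
    λ ()
  ...   | inj₂ t<n = s≤s z≤n , 1≤y , m , m+x , y≤closed (≤-total (m + y) (2 * n))
    where
    m : ℕ
    m = n ∸ suc t

    m+x : m + suc t ≡ n
    m+x = m∸n+n≡m t<n

    y≤nth : y ≤ nth (openers n π) m ∸ suc m
    y≤nth = subst (y ≤_) (rowLength m t (trans (sym (+-suc m t)) m+x)) y≤row

    m<n : m < n
    m<n = m+n≤o⇒m≤o (suc m) (≤-reflexive (trans (sym (+-suc m t)) m+x))

    m+y<nth : m + y < nth (openers n π) m
    m+y<nth = subst (_≤ nth (openers n π) m) (trans (+-suc y m) (cong suc (+-comm y m)))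
      (m≤o∸n⇒m+n≤o y (<⇒≤ (m∸n≢0⇒n<m (m<n⇒n≢0 (≤-trans 1≤y y≤nth)))) y≤nth)

    opened≤m : opened (m + y) ≤ m
    opened≤m = subst (_≤ m) (count-openers (m + y))
      (nth-increasing⁺ openers-increasing (subst (m <_) (sym length-openers) m<n) m+y<nth)

    y≤closed : m + y ≤ 2 * n ⊎ 2 * n ≤ m + y → y ≤ closed (m + y)
    y≤closed (inj₁ q≤2n) = +-cancelˡ-≤ m y (closed (m + y))
      (≤-trans (≤-reflexive (sym (opened+closed q≤2n))) (+-monoˡ-≤ (closed (m + y)) opened≤m))
    -- After the whole path all `n` arches are open or closed, so `n` openers would have occurred,
    -- against the bound `m < n`.
    y≤closed (inj₂ 2n≤q) = contradiction (≤-trans (opened-all 2n≤q) opened≤m) (<⇒≱ m<n)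

  closers-before : ∀ m {x} y → m + x ≡ n → y ≤ closed (m + y) → opened (m + y) ≤ m
  closers-before m y m+x y≤ = +-cancelʳ-≤ y (opened (m + y)) m
    (≤-trans (+-monoʳ-≤ (opened (m + y)) y≤) (≤-reflexive (opened+closed (diagonal≤2n m y m+x y≤))))

  ∈-Y⁺ : ∀ {b} → InY b → b ∈ Y n π
  ∈-Y⁺ {suc t , y} (_ , 1≤y , m , m+x , y≤) = ∈-boxesFrom⁺ 1 (rowLengths n π) t 1≤y
    (subst (y ≤_) (sym (rowLength m t (trans (sym (+-suc m t)) m+x)))
      (m+n≤o⇒m≤o∸n y (subst (_≤ nth (openers n π) m) (sym (trans (+-suc y m) (cong suc (+-comm y m))))
        (nth-increasing⁻ openers-increasing
          (subst (m <_) (sym length-openers) (m+n≤o⇒m≤o (suc m) (≤-reflexive (trans (sym (+-suc m t)) m+x))))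
          (subst (_≤ m) (sym (count-openers (m + y))) (closers-before m y m+x y≤))))))

  -- Diagonals of the diagrams left by the removals.

  -- InY after ℓ rims have been removed.
  InD : ℕ → Box → Set
  InD ℓ (x , y) = 1 ≤ x × 1 ≤ y × ∃[ m ] m + (x + ℓ) ≡ n × y + ℓ ≤ closed (m + (y + ℓ))

  -- Moving left keeps `m` and shortens the prefix of the path, which still has at most `m` openers
  -- and so enough closers. Moving up only enlarges `m`, and `closed` is monotone.
  InD-⊆ : ∀ {ℓ x y x′ y′} → 1 ≤ x′ → x′ ≤ x → 1 ≤ y′ → y′ ≤ y → InD ℓ (x , y) → InD ℓ (x′ , y′)
  InD-⊆ {ℓ} {x} {y} {x′} {y′} 1≤x′ x′≤x 1≤y′ y′≤y (_ , _ , m , m+x , y≤) with m≤n⇒∃[o]m+o≡n x′≤x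
  ... | k , refl = 1≤x′ , 1≤y′ , m + k , trans (shuffle m k x′ ℓ) m+x ,
    ≤-trans (+-cancelˡ-≤ m (y′ + ℓ) (closed (m + (y′ + ℓ))) (begin
      m + (y′ + ℓ)                              ≡⟨ opened+closed q′≤2n ⟨
      opened (m + (y′ + ℓ)) + closed (m + (y′ + ℓ))
        ≤⟨ +-monoˡ-≤ _ (≤-trans (opened-mono q′≤q) (closers-before m (y + ℓ) m+x y≤)) ⟩
      m + closed (m + (y′ + ℓ))                 ∎))
    (closed-mono (+-monoˡ-≤ (y′ + ℓ) (m≤m+n m k)))
    where
    open ≤-Reasoning
    shuffle : ∀ m k x ℓ → m + k + (x + ℓ) ≡ m + (x + k + ℓ)
    shuffle m k x ℓ = solve (m ∷ k ∷ x ∷ ℓ ∷ [])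
    q′≤q : m + (y′ + ℓ) ≤ m + (y + ℓ)
    q′≤q = +-monoʳ-≤ m (+-monoˡ-≤ ℓ y′≤y)
    q′≤2n : m + (y′ + ℓ) ≤ 2 * n
    q′≤2n = ≤-trans q′≤q (diagonal≤2n m (y + ℓ) m+x y≤)

  InD-suc : ∀ {ℓ x y} → 1 ≤ x → 1 ≤ y → InD ℓ (suc x , suc y) → InD (suc ℓ) (x , y)
  InD-suc {ℓ} {x} {y} 1≤x 1≤y (_ , _ , m , m+x , y≤)
    rewrite sym (+-suc x ℓ) | sym (+-suc y ℓ) = 1≤x , 1≤y , m , m+x , y≤

  InD-pred : ∀ {ℓ x y} → InD (suc ℓ) (x , y) → InD ℓ (suc x , suc y)
  InD-pred {ℓ} {x} {y} (_ , _ , m , m+x , y≤)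
    rewrite +-suc x ℓ | +-suc y ℓ = s≤s z≤n , s≤s z≤n , m , m+x , y≤

  -- Here `q = m + (y + ℓ)` equals n - x + y, so it depends only on the diagonal. At least `y + ℓ`
  -- arches are closed by `q`, whence h q = q - 2 (closed q) ≤ n - x - y - 2ℓ = v - 1 - 2ℓ. The last
  -- two bounds come from `1 ≤ y` and `1 ≤ x`.
  box-height : ∀ {ℓ x y v} → InD ℓ (x , y) → v + (x + y) ≡ suc n →
    ∃[ q ] q ≤ 2 * n × height q + suc (ℓ + ℓ) ≤ v × ℓ < closed q × ℓ + opened q < n
  box-height {ℓ} {x} {y} {v} (1≤x , 1≤y , m , m+x , y≤) v+x+y =
    q , q≤2n , bound (height q) (closed q) h+2c y≤ , ≤-trans (+-monoˡ-≤ ℓ 1≤y) y≤ ,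
    opened-bound
    where
    q : ℕ
    q = m + (y + ℓ)

    q≤2n : q ≤ 2 * n
    q≤2n = diagonal≤2n m (y + ℓ) m+x y≤

    h+2c : height q + closed q + closed q ≡ q
    h+2c = trans (cong (_+ closed q) (height+closed q)) (opened+closed q≤2n)

    bound : ∀ h c → h + c + c ≡ m + (y + ℓ) → y + ℓ ≤ c → h + suc (ℓ + ℓ) ≤ v
    -- The summand to be cancelled clears all subtractions, leaving ring identities around two uses
    -- of `y + ℓ ≤ c`.
    bound h c h+2c y+ℓ≤c = +-cancelʳ-≤ (c + c + (m + x + y + y + ℓ)) (h + suc (ℓ + ℓ)) v (begin
      h + suc (ℓ + ℓ) + (c + c + (m + x + y + y + ℓ))            ≡⟨ shuffle₁ h c m x y ℓ ⟩
      h + c + c + suc (m + (x + ℓ)) + (y + ℓ + (y + ℓ))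
        ≤⟨ +-monoʳ-≤ (h + c + c + suc (m + (x + ℓ))) (+-mono-≤ y+ℓ≤c y+ℓ≤c) ⟩
      h + c + c + suc (m + (x + ℓ)) + (c + c)
        ≡⟨ cong (_+ (c + c)) (cong₂ _+_ h+2c (trans (cong suc m+x) (sym v+x+y))) ⟩
      m + (y + ℓ) + (v + (x + y)) + (c + c)                      ≡⟨ shuffle₂ v c m x y ℓ ⟩
      v + (c + c + (m + x + y + y + ℓ))                          ∎)
      where
      open ≤-Reasoning
      shuffle₁ : ∀ h c m x y ℓ → h + suc (ℓ + ℓ) + (c + c + (m + x + y + y + ℓ))
                               ≡ h + c + c + suc (m + (x + ℓ)) + (y + ℓ + (y + ℓ))
      shuffle₁ h c m x y ℓ = solve (h ∷ c ∷ m ∷ x ∷ y ∷ ℓ ∷ [])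
      shuffle₂ : ∀ v c m x y ℓ → m + (y + ℓ) + (v + (x + y)) + (c + c)
                               ≡ v + (c + c + (m + x + y + y + ℓ))
      shuffle₂ v c m x y ℓ = solve (v ∷ c ∷ m ∷ x ∷ y ∷ ℓ ∷ [])

    opened-bound : suc (ℓ + opened q) ≤ n
    opened-bound = begin
      suc (ℓ + opened q) ≡⟨ +-comm (suc ℓ) (opened q) ⟩
      opened q + suc ℓ   ≤⟨ +-mono-≤ (closers-before m (y + ℓ) m+x y≤) (+-monoˡ-≤ ℓ 1≤x) ⟩
      m + (x + ℓ)        ≡⟨ m+x ⟩
      n                  ∎
      where open ≤-Reasoning

  -- The last box on the diagonal of `q` has its column shifted by `ℓ` equal to `closed q` and its
  -- row shifted by `ℓ` equal to n - opened q. There `box-height` is an equality; the two strict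
  -- bounds make column and row positive.
  rim-box : ∀ {ℓ q} → q ≤ 2 * n → ℓ < closed q → ℓ + opened q < n →
    ∃[ x ] ∃[ y ] InD ℓ (x , y) × ¬ InD ℓ (next (x , y)) × (height q + suc (ℓ + ℓ)) + (x + y) ≡ suc n
  rim-box {ℓ} {q} q≤2n ℓ<c ℓ+o<n with m≤n⇒∃[o]m+o≡n ℓ+o<n | m≤n⇒∃[o]m+o≡n ℓ<c
  ... | x , ℓ+o+x | y , ℓ+y =
    suc x , suc y
    , (s≤s z≤n , s≤s z≤n , opened q , trans (shuffle₁ (opened q) x ℓ) ℓ+o+x
      , ≤-reflexive (trans y+ℓ (cong closed (sym o+c))))
    , (λ (_ , _ , m , m+x , y≤) → <⇒≱ (≤-reflexive (cong suc (sym y+ℓ)))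
        (≤-trans y≤ (≤-reflexive (cong closed (trans (m+y m m+x) o+c)))))
    , trans (shuffle₂ (height q) ℓ x y) (cong suc (trans (cong (λ o → suc (ℓ + o + x)) h+ℓ+y) ℓ+o+x))
    where
    y+ℓ : suc y + ℓ ≡ closed q
    y+ℓ = trans (cong suc (+-comm y ℓ)) ℓ+y

    o+c : opened q + (suc y + ℓ) ≡ q
    o+c = trans (cong (opened q +_) y+ℓ) (opened+closed q≤2n)

    h+ℓ+y : height q + (suc ℓ + y) ≡ opened q
    h+ℓ+y = trans (cong (height q +_) ℓ+y) (height+closed q)

    shuffle₁ : ∀ o x ℓ → o + (suc x + ℓ) ≡ suc (ℓ + o) + x
    shuffle₁ o x ℓ = solve (o ∷ x ∷ ℓ ∷ [])

    shuffle₂ : ∀ h ℓ x y → h + suc (ℓ + ℓ) + (suc x + suc y) ≡ suc (suc (ℓ + (h + (suc ℓ + y)) + x))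
    shuffle₂ h ℓ x y = solve (h ∷ ℓ ∷ x ∷ y ∷ [])

    m+y : ∀ m → m + (suc (suc x) + ℓ) ≡ n → m + (suc (suc y) + ℓ) ≡ opened q + (suc y + ℓ)
    m+y m m+x = trans (+-suc m (suc y + ℓ)) (cong (_+ (suc y + ℓ))
      (+-cancelʳ-≡ (suc x + ℓ) (suc m) (opened q)
        (trans (sym (+-suc m (suc x + ℓ))) (trans m+x (sym (trans (shuffle₁ (opened q) x ℓ) ℓ+o+x))))))

  -- The path never goes below the axis: y ≤ closed q ≤ opened q ≤ m. Labels are therefore at least
  -- 1, and truncated subtraction computes them exactly.
  InD-sum≤n : ∀ {ℓ x y} → InD ℓ (x , y) → x + y ≤ n
  InD-sum≤n {ℓ} {x} {y} (_ , _ , m , m+x , y≤) = begin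
    x + y           ≡⟨ +-comm x y ⟩
    y + x           ≤⟨ +-mono-≤ y≤m (m≤m+n x ℓ) ⟩
    m + (x + ℓ)     ≡⟨ m+x ⟩
    n               ∎
    where
    open ≤-Reasoning
    q : ℕ
    q = m + (y + ℓ)
    y≤m : y ≤ m
    y≤m = begin
      y          ≤⟨ m≤m+n y ℓ ⟩
      y + ℓ      ≤⟨ y≤ ⟩
      closed q   ≤⟨ m≤n+m (closed q) (height q) ⟩
      height q + closed q ≡⟨ height+closed q ⟩
      opened q   ≤⟨ closers-before m (y + ℓ) m+x y≤ ⟩
      m          ∎

  -- Rims of the successive diagrams.

  record Represents (ℓ : ℕ) (D : List Box) : Set where
    field
      sound    : ∀ {b} → b ∈ D → InD ℓ b
      complete : ∀ {b} → InD ℓ b → b ∈ D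

  Y-represents : Represents 0 (Y n π)
  Y-represents = record { sound = sound ; complete = complete }
    where
    sound : ∀ {b} → b ∈ Y n π → InD 0 b
    sound {x , y} b∈ with ∈-Y⁻ b∈
    ... | inY rewrite +-identityʳ x | +-identityʳ y = inY
    complete : ∀ {b} → InD 0 b → b ∈ Y n π
    complete {x , y} inD rewrite +-identityʳ x | +-identityʳ y = ∈-Y⁺ inD

  -- A box survives exactly when it and its diagonal successor are present, so each removal shifts
  -- the membership condition by one step along the diagonal.
  removeRim-represents : ∀ {ℓ D} → Represents ℓ D → Represents (suc ℓ) (removeRim D)
  removeRim-represents {ℓ} {D} rep = record { sound = sound′ ; complete = complete′ }
    where
    open Represents rep
    sound′ : ∀ {b} → b ∈ removeRim D → InD (suc ℓ) b
    sound′ b∈ with ∈-removeRim⁻ D b∈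
    ... | b∈D , next∈D with sound b∈D
    ...   | 1≤x , 1≤y , _ = InD-suc 1≤x 1≤y (sound next∈D)
    complete′ : ∀ {b} → InD (suc ℓ) b → b ∈ removeRim D
    complete′ {x , y} inD@(1≤x , 1≤y , _) = ∈-removeRim⁺ D
      (complete (InD-⊆ 1≤x (n≤1+n x) 1≤y (n≤1+n y) (InD-pred inD))) (complete (InD-pred inD))

  module Rim {ℓ D} (rep : Represents ℓ D) {b₀} (b₀∈D : b₀ ∈ D) where
    open Represents rep

    rim⁺ : ∀ {b} → InD ℓ b → ¬ InD ℓ (next b) → b ∈ rim D
    rim⁺ inD ¬next = ∈-rim⁺ D (complete inD) (¬next ∘ sound)

    rim-InD : ∀ {b} → b ∈ rim D → InD ℓ b
    rim-InD b∈ = sound (proj₁ (∈-rim⁻ D b∈))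

    -- Nothing lies below the lowest row, so its first box has no diagonal successor and belongs to
    -- the rim. Maximality is stated for the whole diagram, since it is later tested against boxes
    -- not known to lie on the rim.
    bottom-corner : ∃[ x ] bottomLeft (rim D) ≡ (x , 1) × (x , 1) ∈ rim D
                         × (∀ {x′ y′} → InD ℓ (x′ , y′) → x′ ≤ x)
    bottom-corner with ∈-map⁻ proj₁ (maxL-∈ (∈-map⁺ proj₁ b₀∈D) (proj₁ (sound b₀∈D)))
    ... | (x , y) , b∈D , max≡x =
      x , corner≡ , corner∈rim , maximal
      where
      maximal : ∀ {x′ y′} → InD ℓ (x′ , y′) → x′ ≤ x
      maximal inD = subst (_ ≤_) max≡x (≤-maxL (∈-map⁺ proj₁ (complete inD)))

      corner∈rim : (x , 1) ∈ rim D
      corner∈rim = rim⁺ (InD-⊆ (proj₁ (sound b∈D)) ≤-refl ≤-refl (proj₁ (proj₂ (sound b∈D))) (sound b∈D))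
        (<⇒≱ (n<1+n x) ∘ maximal)

      row≡ : maxL (map proj₁ (rim D)) ≡ x
      row≡ = maxL-unique (∈-map⁺ proj₁ corner∈rim) λ x′∈ →
        let c , c∈ , x′≡ = ∈-map⁻ proj₁ x′∈ in subst (_≤ x) (sym x′≡) (maximal (rim-InD c∈))

      row : List Box
      row = filterᵇ (λ b → proj₁ b ≡ᵇ x) (rim D)

      column≡ : minL (map proj₂ row) ≡ 1
      column≡ = minL-unique
        (∈-map⁺ proj₂ (∈-filter⁺ (T? ∘ (λ b → proj₁ b ≡ᵇ x)) corner∈rim (≡⇒≡ᵇ x x refl)))
        λ y′∈ → let c , c∈ , y′≡ = ∈-map⁻ proj₂ y′∈
                    c∈rim , _    = ∈-filter⁻ (T? ∘ (λ b → proj₁ b ≡ᵇ x)) {xs = rim D} c∈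
                in subst (1 ≤_) (sym y′≡) (proj₁ (proj₂ (rim-InD c∈rim)))

      corner≡ : bottomLeft (rim D) ≡ (x , 1)
      corner≡ = trans
        (cong (λ s → s , minL (map proj₂ (filterᵇ (λ b → proj₁ b ≡ᵇ s) (rim D)))) row≡)
        (cong (x ,_) column≡)

    top-corner : ∃[ y ] topRight (rim D) ≡ (1 , y) × (1 , y) ∈ rim D
                      × (∀ {x′ y′} → InD ℓ (x′ , y′) → y′ ≤ y)
    top-corner with ∈-map⁻ proj₂ (maxL-∈ (∈-map⁺ proj₂ b₀∈D) (proj₁ (proj₂ (sound b₀∈D))))
    ... | (x , y) , b∈D , max≡y =
      y , corner≡ , corner∈rim , maximal
      where
      maximal : ∀ {x′ y′} → InD ℓ (x′ , y′) → y′ ≤ y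
      maximal inD = subst (_ ≤_) max≡y (≤-maxL (∈-map⁺ proj₂ (complete inD)))

      corner∈rim : (1 , y) ∈ rim D
      corner∈rim = rim⁺ (InD-⊆ ≤-refl (proj₁ (sound b∈D)) (proj₁ (proj₂ (sound b∈D))) ≤-refl (sound b∈D))
        (<⇒≱ (n<1+n y) ∘ maximal)

      row≡ : minL (map proj₁ (rim D)) ≡ 1
      row≡ = minL-unique (∈-map⁺ proj₁ corner∈rim) λ x′∈ →
        let c , c∈ , x′≡ = ∈-map⁻ proj₁ x′∈ in subst (1 ≤_) (sym x′≡) (proj₁ (rim-InD c∈))

      row : List Box
      row = filterᵇ (λ b → proj₁ b ≡ᵇ 1) (rim D)

      column≡ : maxL (map proj₂ row) ≡ y
      column≡ = maxL-unique
        (∈-map⁺ proj₂ (∈-filter⁺ (T? ∘ (λ b → proj₁ b ≡ᵇ 1)) corner∈rim tt))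
        λ y′∈ → let c , c∈ , y′≡ = ∈-map⁻ proj₂ y′∈
                    c∈rim , _    = ∈-filter⁻ (T? ∘ (λ b → proj₁ b ≡ᵇ 1)) {xs = rim D} c∈
                in subst (_≤ y) (sym y′≡) (maximal (rim-InD c∈rim))

      corner≡ : topRight (rim D) ≡ (1 , y)
      corner≡ = trans
        (cong (λ s → s , maxL (map proj₂ (filterᵇ (λ b → proj₁ b ≡ᵇ s) (rim D)))) row≡)
        (cong (1 ,_) column≡)

    minimum-label : ∃[ k ] minZ (map (label n) (rim D)) ≡ ℤ.+ k
      × (∃[ x ] ∃[ y ] InD ℓ (x , y) × k + (x + y) ≡ suc n)
      × (∀ {x y v} → (x , y) ∈ rim D → v + (x + y) ≡ suc n → k ≤ v)
    minimum-label with bottom-corner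
    ... | _ , _ , corner∈rim , _ with ∈-map⁻ (label n) (minZ-∈ (∈-map⁺ (label n) corner∈rim))
    ...   | (x , y) , c∈ , min≡ =
      k , k≡ , (x , y , rim-InD c∈ , k+x+y)
      , λ {x′} {y′} b∈ v≡ → ℤ.drop‿+≤+ (subst₂ ℤ._≤_ k≡ (label-+ x′ y′ v≡) (minZ-≤ (∈-map⁺ (label n) b∈)))
      where
      k : ℕ
      k = suc n ∸ (x + y)
      k+x+y : k + (x + y) ≡ suc n
      k+x+y = m∸n+n≡m (m≤n⇒m≤1+n (InD-sum≤n (rim-InD c∈)))
      k≡ : minZ (map (label n) (rim D)) ≡ ℤ.+ k
      k≡ = trans min≡ (label-+ x y k+x+y)

  -- Height bounds for a fixed `p`.

  module At {p r} (p≤n : p ≤ n) (p+r : p + r ≡ 2 * n) where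

    d e M : ℕ
    d = closed p
    e = n ∸ opened r
    M = spanning p r

    e+opened : e + opened r ≡ n
    e+opened = m∸n+n≡m (opened≤n r)

    p≤r : p ≤ r
    p≤r = +-cancelˡ-≤ p p r (begin
      p + p   ≤⟨ +-mono-≤ p≤n (≤-trans p≤n (m≤m+n n 0)) ⟩
      2 * n   ≡⟨ p+r ⟨
      p + r   ∎)
      where open ≤-Reasoning

    r≤2n : r ≤ 2 * n
    r≤2n = subst (r ≤_) p+r (m≤n+m r p)

    p≤2n : p ≤ 2 * n
    p≤2n = ≤-trans p≤r r≤2n

    height-p : height p + (d + d) ≡ p
    height-p = trans (sym (+-assoc (height p) d d))
      (trans (cong (_+ d) (height+closed p)) (opened+closed p≤2n))

    height-r : height r + (e + e) ≡ p
    height-r = solution (height+closed r) (opened+closed r≤2n) e+opened p+r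
      where
      solution : ∀ {h c o e n p} → h + c ≡ o → o + c ≡ r → e + o ≡ n → p + r ≡ 2 * n → h + (e + e) ≡ p
      solution {h} {c} {_} {e} {_} {p} refl refl refl p+r = +-cancelʳ-≡ (h + c + c) (h + (e + e)) p
        (trans (shuffle h c e) (sym p+r))
        where
        shuffle : ∀ h c e → h + (e + e) + (h + c + c) ≡ 2 * (e + (h + c))
        shuffle h c e = solve (h ∷ c ∷ e ∷ [])

    M≤height-p : M ≤ height p
    M≤height-p = spanning≤height ≤-refl p≤r

    M≤height-r : M ≤ height r
    M≤height-r = spanning≤height p≤r ≤-refl

    X : ℕ
    X = p ∸ M

    M+X : M + X ≡ p
    M+X = m+[n∸m]≡n (≤-trans M≤height-p (subst (height p ≤_) height-p (m≤m+n (height p) (d + d))))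

    ≤X : ∀ {s} → M + s ≤ p → s ≤ X
    ≤X {s} M+s≤p = +-cancelˡ-≤ M s X (≤-trans M+s≤p (≤-reflexive (sym M+X)))

    -- From M ≤ h p = p - 2d. With its mirror `2e≤X` it settles diagonals outside [p, r] and makes
    -- the subtractions in the final formula exact.
    2d≤X : d + d ≤ X
    2d≤X = ≤X (≤-trans (+-monoˡ-≤ (d + d) M≤height-p) (≤-reflexive height-p))

    2e≤X : e + e ≤ X
    2e≤X = ≤X (≤-trans (+-monoˡ-≤ (e + e) M≤height-r) (≤-reflexive height-r))

    -- From d ≤ ℓ < closed q it follows that p < q. If q ≤ r, then M ≤ h q and `box-height` gives M
    -- + 2ℓ + 1 ≤ v ≤ p. If r < q, then ℓ < e, and 2e ≤ X suffices.
    label≤p⇒ : ∀ {ℓ x y v} → InD ℓ (x , y) → v + (x + y) ≡ suc n → d ≤ ℓ → v ≤ p → suc (ℓ + ℓ) ≤ X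
    label≤p⇒ {ℓ} inD v≡ d≤ℓ v≤p with box-height inD v≡
    ... | q , _ , h≤v , ℓ<closed , ℓ+opened<n with ≤-<-connex q r
    ...   | inj₁ q≤r = ≤X (≤-trans (+-monoˡ-≤ _ (spanning≤height (<⇒≤ p<q) q≤r)) (≤-trans h≤v v≤p))
      where
      p<q : p < q
      p<q = ≰⇒> λ q≤p → <⇒≱ (≤-<-trans d≤ℓ ℓ<closed) (closed-mono q≤p)
    ...   | inj₂ r<q = ≤-trans (+-mono-≤ ℓ<e (<⇒≤ ℓ<e)) 2e≤X
      where
      ℓ<e : ℓ < e
      ℓ<e = +-cancelʳ-< (opened r) ℓ e (≤-<-trans (+-monoʳ-≤ ℓ (opened-mono (<⇒≤ r<q)))
        (<-≤-trans ℓ+opened<n (≤-reflexive (sym e+opened))))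

    -- The mirror case: `e ≤ ℓ` forces q < r, and q < p gives ℓ < d. The strict bound on `v` yields
    -- the extra unit.
    label<p⇒ : ∀ {ℓ x y v} → InD ℓ (x , y) → v + (x + y) ≡ suc n → e ≤ ℓ → v < p → suc (suc (ℓ + ℓ)) ≤ X
    label<p⇒ {ℓ} inD v≡ e≤ℓ v<p with box-height inD v≡
    ... | q , _ , h≤v , ℓ<closed , ℓ+opened<n with ≤-<-connex p q
    ...   | inj₁ p≤q = ≤X (≤-trans (≤-reflexive (+-suc M (suc (ℓ + ℓ))))
                (≤-trans (s≤s (≤-trans (+-monoˡ-≤ _ (spanning≤height p≤q (<⇒≤ q<r))) h≤v)) v<p))
      where
      q<r : q < r
      q<r = ≰⇒> λ r≤q → <⇒≱ ℓ+opened<n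
        (≤-trans (≤-reflexive (sym e+opened)) (+-mono-≤ e≤ℓ (opened-mono r≤q)))
    ...   | inj₂ q<p = ≤-trans (≤-reflexive (cong suc (sym (+-suc ℓ ℓ)))) (≤-trans (+-mono-≤ ℓ<d ℓ<d) 2d≤X)
      where
      ℓ<d : ℓ < d
      ℓ<d = <-≤-trans ℓ<closed (closed-mono (<⇒≤ q<p))

    -- The box is taken on the diagonal of the lowest point `q` of [p, r]. It exists because 2ℓ + 1
    -- ≤ p - M ≤ q - h q = 2 (closed q) and 2ℓ + 1 + 2 (opened q) = h q + 2ℓ + 1 + q ≤ M + X + r =
    -- 2n; `<-half` halves both.
    low-box : ∀ {ℓ} → suc (ℓ + ℓ) ≤ X →
      ∃[ x ] ∃[ y ] ∃[ v ] InD ℓ (x , y) × ¬ InD ℓ (next (x , y)) × v + (x + y) ≡ suc n × v ≤ M + suc (ℓ + ℓ)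
    low-box {ℓ} 2ℓ<X with height-minimum p≤r
    ... | q , p≤q , q≤r , h≤M
      with rim-box (≤-trans q≤r r≤2n)
             (<-half (closers h≤M (height+closed q) (opened+closed (≤-trans q≤r r≤2n))))
             (<-half (openers′ h≤M (height+closed q) (opened+closed (≤-trans q≤r r≤2n))))
      where
      closers : ∀ {h c o} → h ≤ M → h + c ≡ o → o + c ≡ q → suc (ℓ + ℓ) ≤ c + c
      closers {h} {c} h≤M refl o+c = +-cancelˡ-≤ h (suc (ℓ + ℓ)) (c + c) (begin
        h + suc (ℓ + ℓ)  ≤⟨ +-mono-≤ h≤M 2ℓ<X ⟩
        M + X            ≡⟨ M+X ⟩
        p                ≤⟨ p≤q ⟩
        q                ≡⟨ o+c ⟨
        h + c + c        ≡⟨ +-assoc h c c ⟩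
        h + (c + c)      ∎)
        where open ≤-Reasoning

      openers′ : ∀ {h c o} → h ≤ M → h + c ≡ o → o + c ≡ q → suc (ℓ + o + (ℓ + o)) ≤ n + n
      openers′ {h} {c} h≤M refl o+c = begin
        suc (ℓ + (h + c) + (ℓ + (h + c)))  ≡⟨ shuffle h c ℓ ⟩
        h + suc (ℓ + ℓ) + (h + c + c)      ≤⟨ +-mono-≤ (+-mono-≤ h≤M 2ℓ<X) (≤-trans (≤-reflexive o+c) q≤r) ⟩
        M + X + r                          ≡⟨ cong (_+ r) M+X ⟩
        p + r                              ≡⟨ p+r ⟩
        2 * n                              ≡⟨ cong (n +_) (+-identityʳ n) ⟩
        n + n                              ∎
        where
        open ≤-Reasoning
        shuffle : ∀ h c ℓ → suc (ℓ + (h + c) + (ℓ + (h + c))) ≡ h + suc (ℓ + ℓ) + (h + c + c)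
        shuffle h c ℓ = solve (h ∷ c ∷ ℓ ∷ [])
    ... | x , y , inD , ¬next , label≡ =
      x , y , height q + suc (ℓ + ℓ) , inD , ¬next , label≡ , +-monoˡ-≤ (suc (ℓ + ℓ)) h≤M

    -- The corners of one rim and its contribution.

    module Corners {ℓ D} (rep : Represents ℓ D) {b₀} (b₀∈D : b₀ ∈ D) where
      open Rim rep b₀∈D

      -- The corner lies on the diagonal of i + 1. If i < p, then ℓ < closed (i + 1) ≤ d.
      bottom⇒ : ∀ {i x} → InD ℓ (x , 1) → i + x ≡ n → d ≤ ℓ → p ≤ i
      bottom⇒ {i} {x} (_ , _ , m , m+x , ℓ<closed) i+x d≤ℓ = ≮⇒≥ λ i<p →
        <⇒≱ ℓ<closed (≤-trans (closed-mono (subst (_≤ p) (sym q≡) i<p)) d≤ℓ)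
        where
        q≡ : m + suc ℓ ≡ suc i
        q≡ = trans (+-suc m ℓ) (cong suc (+-cancelʳ-≡ x (m + ℓ) i
          (trans (trans (+-assoc m ℓ x) (cong (m +_) (+-comm ℓ x))) (trans m+x (sym i+x)))))

      -- If ℓ < d, the box of column 1 on the diagonal of `p`, in row n - p + 1, is still present,
      -- so x > n - p and i < p.
      bottom⇐ : ∀ {i x} → (∀ {x′ y′} → InD ℓ (x′ , y′) → x′ ≤ x) → i + x ≡ n → p ≤ i → d ≤ ℓ
      bottom⇐ {i} {x} maximal i+x p≤i = ≮⇒≥ contra
        where
        d≤p : d ≤ p
        d≤p = subst (d ≤_) (opened+closed p≤2n) (m≤n+m d (opened p))
        contra : ¬ ℓ < d
        contra ℓ<d with m≤n⇒∃[o]m+o≡n (<-≤-trans ℓ<d d≤p) | m≤n⇒∃[o]m+o≡n p≤n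
        ... | m , ℓ+m | o , p+o = <⇒≱ (≤-refl {suc (i + x)})
          (≤-trans (≤-reflexive (cong suc (trans i+x (sym p+o))))
            (≤-trans (≤-reflexive (sym (+-suc p o))) (+-mono-≤ p≤i (maximal box))))
          where
          m+ℓ : m + suc ℓ ≡ p
          m+ℓ = trans (+-comm m (suc ℓ)) ℓ+m
          shuffle : ∀ m o ℓ → m + (suc o + ℓ) ≡ m + suc ℓ + o
          shuffle m o ℓ = solve (m ∷ o ∷ ℓ ∷ [])
          box : InD ℓ (suc o , 1)
          box = s≤s z≤n , s≤s z≤n , m , trans (shuffle m o ℓ) (trans (cong (_+ o) m+ℓ) p+o)
              , subst (ℓ <_) (cong closed (sym m+ℓ)) ℓ<d

      -- The corner lies on the diagonal of 2n - 1 - j, which is at least `r` if j < p. Then opened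
      -- r ≤ m = n - 1 - ℓ, so ℓ < e.
      top⇒ : ∀ {j y} → InD ℓ (1 , y) → j + y ≡ n → e ≤ ℓ → p ≤ j
      top⇒ {j} {y} (_ , _ , m , m+1 , y≤) j+y e≤ℓ = ≮⇒≥ λ j<p → <⇒≱ (ℓ+m<n m+1)
        (≤-trans (≤-reflexive (sym e+opened))
          (+-mono-≤ e≤ℓ (≤-trans (opened-mono (r≤q j<p)) (closers-before m (y + ℓ) m+1 y≤))))
        where
        ℓ+m<n : m + suc ℓ ≡ n → ℓ + m < n
        ℓ+m<n eq = ≤-reflexive (trans (+-comm (suc ℓ) m) eq)
        r≤q : j < p → r ≤ m + (y + ℓ)
        r≤q j<p = +-cancelˡ-≤ p r (m + (y + ℓ)) (begin
          p + r                   ≡⟨ p+r ⟩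
          2 * n                   ≡⟨ cong (n +_) (+-identityʳ n) ⟩
          n + n                   ≡⟨ cong₂ _+_ m+1 j+y ⟨
          m + suc ℓ + (j + y)     ≡⟨ shuffle m ℓ j y ⟩
          suc j + (m + (y + ℓ))   ≤⟨ +-monoˡ-≤ (m + (y + ℓ)) j<p ⟩
          p + (m + (y + ℓ))       ∎)
          where
          open ≤-Reasoning
          shuffle : ∀ m ℓ j y → m + suc ℓ + (j + y) ≡ suc j + (m + (y + ℓ))
          shuffle m ℓ j y = solve (m ∷ ℓ ∷ j ∷ y ∷ [])

      -- If ℓ < e, the box of row 1 on the diagonal of `r`, in column n - p + 1, is still present,
      -- so y > n - p and j < p.
      top⇐ : ∀ {j y} → (∀ {x′ y′} → InD ℓ (x′ , y′) → y′ ≤ y) → j + y ≡ n → p ≤ j → e ≤ ℓ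
      top⇐ {j} {y} maximal j+y p≤j = ≮⇒≥ contra
        where
        contra : ¬ ℓ < e
        contra ℓ<e with m≤n⇒∃[o]m+o≡n (<-≤-trans ℓ<e (m∸n≤m n (opened r))) | m≤n⇒∃[o]m+o≡n p≤n
        ... | m , ℓ+m | o , p+o = <⇒≱ (≤-refl {suc (j + y)})
          (≤-trans (≤-reflexive (cong suc (trans j+y (sym p+o))))
            (≤-trans (≤-reflexive (sym (+-suc p o))) (+-mono-≤ p≤j (maximal box))))
          where
          m+ℓ : m + suc ℓ ≡ n
          m+ℓ = trans (+-comm m (suc ℓ)) ℓ+m
          n+o : n + o ≡ r
          n+o = +-cancelˡ-≡ p (n + o) r (trans (shuffle p n o)
            (trans (cong (n +_) p+o) (trans (cong (n +_) (sym (+-identityʳ n))) (sym p+r))))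
            where
            shuffle : ∀ p n o → p + (n + o) ≡ n + (p + o)
            shuffle p n o = solve (p ∷ n ∷ o ∷ [])
          q≡r : m + (suc o + ℓ) ≡ r
          q≡r = trans (shuffle m o ℓ) (trans (cong (_+ o) m+ℓ) n+o)
            where
            shuffle : ∀ m o ℓ → m + (suc o + ℓ) ≡ m + suc ℓ + o
            shuffle m o ℓ = solve (m ∷ o ∷ ℓ ∷ [])
          y≤closed : suc o + ℓ ≤ closed r
          y≤closed = +-cancelˡ-≤ (opened r) (suc o + ℓ) (closed r) (begin
            opened r + (suc o + ℓ)  ≡⟨ shuffle (opened r) o ℓ ⟩
            suc ℓ + opened r + o    ≤⟨ +-monoˡ-≤ o (+-monoˡ-≤ (opened r) ℓ<e) ⟩
            e + opened r + o        ≡⟨ cong (_+ o) e+opened ⟩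
            n + o                   ≡⟨ n+o ⟩
            r                       ≡⟨ opened+closed r≤2n ⟨
            opened r + closed r     ∎)
            where
            open ≤-Reasoning
            shuffle : ∀ c o ℓ → c + (suc o + ℓ) ≡ suc ℓ + c + o
            shuffle c o ℓ = solve (c ∷ o ∷ ℓ ∷ [])
          box : InD ℓ (1 , suc o)
          box = s≤s z≤n , s≤s z≤n , m , m+ℓ , ≤-trans y≤closed (≤-reflexive (cong closed (sym q≡r)))

      count-rim-corners : ∀ {x y k x₀ y₀}
        → bottomLeft (rim D) ≡ (x , 1) → (x , 1) ∈ rim D → (∀ {x′ y′} → InD ℓ (x′ , y′) → x′ ≤ x)
        → topRight (rim D) ≡ (1 , y) → (1 , y) ∈ rim D → (∀ {x′ y′} → InD ℓ (x′ , y′) → y′ ≤ y)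
        → minZ (map (label n) (rim D)) ≡ ℤ.+ k → InD ℓ (x₀ , y₀) → k + (x₀ + y₀) ≡ suc n
        → (∀ {x y v} → (x , y) ∈ rim D → v + (x + y) ≡ suc n → k ≤ v)
        → count (isℤ p) (Bset n (rim D)) ≡ ind (between d ℓ ⌈ X /2⌉) + ind (between e ℓ ⌊ X /2⌋)
      count-rim-corners {x} {y} {k} bl≡ bl∈ x-max tr≡ tr∈ y-max min≡ inD₀ k+ k-min = begin
        count (isℤ p) (Bset n (rim D))
          ≡⟨ count-Bset n (rim D) p (trans (cong (label n) bl≡) (label-+ x 1 i+))
               (trans (cong (label n) tr≡) (label-+ 1 y j+))
               min≡ k≤i k≤j ⟩
        ind (k ≡ᵇ p) + (ind (within k p i) + ind (within k p j))
          ≡⟨ +-assoc (ind (k ≡ᵇ p)) (ind (within k p i)) (ind (within k p j)) ⟨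
        ind (k ≡ᵇ p) + ind (within k p i) + ind (within k p j)
          ≡⟨ cong₂ _+_ (trans (ind-≡-within k p i k≤i) (ind-cong to₁ from₁)) (ind-cong to₂ from₂) ⟩
        ind (between d ℓ ⌈ X /2⌉) + ind (between e ℓ ⌊ X /2⌋) ∎
        where
        open ≡-Reasoning
        i j : ℕ
        i = n ∸ x
        j = n ∸ y
        i+x : i + x ≡ n
        i+x = m∸n+n≡m (m+n≤o⇒m≤o x (InD-sum≤n (rim-InD bl∈)))
        j+y : j + y ≡ n
        j+y = m∸n+n≡m (m+n≤o⇒n≤o 1 (InD-sum≤n (rim-InD tr∈)))
        i+ : i + (x + 1) ≡ suc n
        i+ = trans (cong (i +_) (+-comm x 1)) (trans (+-suc i x) (cong suc i+x))
        j+ : j + (1 + y) ≡ suc n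
        j+ = trans (+-suc j y) (cong suc j+y)
        k≤i : k ≤ i
        k≤i = k-min bl∈ i+
        k≤j : k ≤ j
        k≤j = k-min tr∈ j+
        -- The minimal label is bounded by that of the rim box over the lowest point of [p, r].
        k≤ : ∀ {s} → suc (ℓ + ℓ) ≤ X → M + suc (ℓ + ℓ) ≤ s → k ≤ s
        k≤ 2ℓ<X M+≤s with low-box 2ℓ<X
        ... | x , y , v , inD , ¬next , v+ , v≤ = ≤-trans (k-min (rim⁺ inD ¬next) v+) (≤-trans v≤ M+≤s)
        -- The corner comes first: it yields `d ≤ ℓ`, which `label≤p⇒` requires of the box attaining
        -- `k`.
        to₁ : T (between k p (suc i)) → T (between d ℓ ⌈ X /2⌉)
        to₁ t = let k≤p , p<si = between⁻ k p (suc i) t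
                    d≤ℓ        = bottom⇐ x-max i+x (s≤s⁻¹ p<si)
                in between⁺ d ℓ _ d≤ℓ (<-⌈/2⌉⁺ X (label≤p⇒ inD₀ k+ d≤ℓ k≤p))
        from₁ : T (between d ℓ ⌈ X /2⌉) → T (between k p (suc i))
        from₁ t = let d≤ℓ , ℓ< = between⁻ d ℓ ⌈ X /2⌉ t
                      2ℓ<X     = <-⌈/2⌉⁻ X ℓ<
                  in between⁺ k p (suc i) (k≤ 2ℓ<X (≤-trans (+-monoʳ-≤ M 2ℓ<X) (≤-reflexive M+X)))
                       (s≤s (bottom⇒ (rim-InD bl∈) i+x d≤ℓ))
        to₂ : T (within k p j) → T (between e ℓ ⌊ X /2⌋)
        to₂ t = let k<p , p≤j = within⁻ k p j t
                    e≤ℓ       = top⇐ y-max j+y p≤j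
                in between⁺ e ℓ _ e≤ℓ (<-⌊/2⌋⁺ X (label<p⇒ inD₀ k+ e≤ℓ k<p))
        from₂ : T (between e ℓ ⌊ X /2⌋) → T (within k p j)
        from₂ t = let e≤ℓ , ℓ< = between⁻ e ℓ ⌊ X /2⌋ t
                      2ℓ+1<X   = <-⌊/2⌋⁻ X ℓ<
                  in within⁺ k p j
                       (≤-trans (s≤s (k≤ (<⇒≤ 2ℓ+1<X) ≤-refl))
                         (≤-trans (≤-reflexive (sym (+-suc M (suc (ℓ + ℓ)))))
                           (≤-trans (+-monoʳ-≤ M 2ℓ+1<X) (≤-reflexive M+X))))
                       (top⇒ (rim-InD tr∈) j+y e≤ℓ)

      count-rim : count (isℤ p) (Bset n (rim D)) ≡ ind (between d ℓ ⌈ X /2⌉) + ind (between e ℓ ⌊ X /2⌋)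
      count-rim =
        let _ , bl≡ , bl∈ , x-max                      = bottom-corner
            _ , tr≡ , tr∈ , y-max                      = top-corner
            _ , min≡ , (_ , _ , inD₀ , k+) , k-min     = minimum-label
        in count-rim-corners bl≡ bl∈ x-max tr≡ tr∈ y-max min≡ inD₀ k+ k-min

    -- Summation over the rims.

    -- The total contribution of the rims with index at least `ℓ`: those indices from `d` up to
    -- `⌈ X /2⌉` and from `e` up to `⌊ X /2⌋`, upper ends excluded.
    remaining : ℕ → ℕ
    remaining ℓ = (⌈ X /2⌉ ∸ (d ⊔ ℓ)) + (⌊ X /2⌋ ∸ (e ⊔ ℓ))

    -- Were ℓ below `⌈ X /2⌉`, `low-box` would exhibit a box of the empty diagram.
    remaining-empty : ∀ {ℓ} → Represents ℓ [] → remaining ℓ ≡ 0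
    remaining-empty {ℓ} rep = cong₂ _+_
      (m≤n⇒m∸n≡0 (≤-trans ⌈X/2⌉≤ℓ (m≤n⊔m d ℓ)))
      (m≤n⇒m∸n≡0 (≤-trans (⌊n/2⌋≤⌈n/2⌉ X) (≤-trans ⌈X/2⌉≤ℓ (m≤n⊔m e ℓ))))
      where
      ⌈X/2⌉≤ℓ : ⌈ X /2⌉ ≤ ℓ
      ⌈X/2⌉≤ℓ = ≮⇒≥ λ ℓ< → let _ , _ , _ , inD , _ = low-box (<-⌈/2⌉⁻ X ℓ<) in
        contradiction (Represents.complete rep inD) λ ()

    remaining-step : ∀ ℓ → remaining ℓ ≡
      ind (between d ℓ ⌈ X /2⌉) + ind (between e ℓ ⌊ X /2⌋) + remaining (suc ℓ)
    remaining-step ℓ rewrite ∸-step ⌈ X /2⌉ d ℓ | ∸-step ⌊ X /2⌋ e ℓ =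
      shuffle (ind (between d ℓ ⌈ X /2⌉)) (⌈ X /2⌉ ∸ (d ⊔ suc ℓ))
              (ind (between e ℓ ⌊ X /2⌋)) (⌊ X /2⌋ ∸ (e ⊔ suc ℓ))
      where
      shuffle : ∀ a b c d → a + b + (c + d) ≡ a + c + (b + d)
      shuffle a b c d = solve (a ∷ b ∷ c ∷ d ∷ [])

    count-rims : ∀ f {ℓ} D → Represents ℓ D → length D ≤ f →
                 count (isℤ p) (concatMap (Bset n) (rimsFuel f D)) ≡ remaining ℓ
    count-rims zero    []      rep _ = sym (remaining-empty rep)
    count-rims (suc f) []      rep _ = sym (remaining-empty rep)
    count-rims (suc f) {ℓ} D@(_ ∷ _) rep D≤f = begin
      count (isℤ p) (Bset n (rim D) ++ concatMap (Bset n) (rimsFuel f (removeRim D)))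
        ≡⟨ count-++ (isℤ p) (Bset n (rim D)) _ ⟩
      count (isℤ p) (Bset n (rim D)) + count (isℤ p) (concatMap (Bset n) (rimsFuel f (removeRim D)))
        ≡⟨ cong₂ _+_ (Corners.count-rim rep (here refl))
             (count-rims f (removeRim D) (removeRim-represents rep) (s≤s⁻¹ (≤-trans shrinks D≤f))) ⟩
      ind (between d ℓ ⌈ X /2⌉) + ind (between e ℓ ⌊ X /2⌋) + remaining (suc ℓ)
        ≡⟨ remaining-step ℓ ⟨
      remaining ℓ ∎
      where
      open ≡-Reasoning
      -- The bottom-left corner is always lost, so the fuel outlasts the diagram.
      shrinks : length (removeRim D) < length D
      shrinks = let _ , _ , corner∈ , _ = Rim.bottom-corner rep (here refl)
                    corner∈D , ¬next    = ∈-rim⁻ D corner∈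
                in removeRim-shrinks D corner∈D ¬next

    mB≡ : mB n π p ≡ (⌈ X /2⌉ ∸ d) + (⌊ X /2⌋ ∸ e)
    mB≡ = trans (count-rims (length (Y n π)) (Y n π) Y-represents ≤-refl)
      (cong₂ (λ s t → (⌈ X /2⌉ ∸ s) + (⌊ X /2⌋ ∸ t)) (⊔-identityʳ d) (⊔-identityʳ e))

    -- Evaluation of Rule A.

    hat≡ : hat n p ≡ suc r
    hat≡ = trans (cong (_∸ p) (trans (+-comm (2 * n) 1) (trans (cong suc (sym p+r)) (sym (+-suc p r)))))
      (m+n∸m≡n p (suc r))

    -- An arch open at `p` closes either by `r`, that is before `hat n p`, or after `r`. In `AR+M`
    -- the arches open at `r` split by whether they open after `p`.
    AL+M : length (ALset n π p) + M ≡ height p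
    AL+M rewrite hat≡ = count-add _ (spans p r) (spans p p) π λ {a} _ → pointwise a
      where
      pointwise : ∀ a → ind ((proj₁ a ≤ᵇ p) ∧ (p <ᵇ proj₂ a) ∧ (proj₂ a <ᵇ suc r)) + ind (spans p r a)
                      ≡ ind (spans p p a)
      pointwise (a₁ , a₂) with a₁ ≤ᵇ p
      ... | false = refl
      ... | true with ≤-<-connex a₂ r
      ...   | inj₁ a₂≤r rewrite ≤ᵇ-true (s≤s a₂≤r) | ≤ᵇ-false (s≤s a₂≤r) | ∧-identityʳ (p <ᵇ a₂) = +-identityʳ _
      ...   | inj₂ r<a₂ rewrite ≤ᵇ-false (s≤s r<a₂) | ≤ᵇ-true r<a₂ | ≤ᵇ-true (≤-<-trans p≤r r<a₂) = refl

    AR+M : length (ARset n π p) + M ≡ height r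
    AR+M rewrite hat≡ = count-add _ (spans p r) (spans r r) π λ {a} _ → pointwise a
      where
      pointwise : ∀ a → ind ((p <ᵇ proj₁ a) ∧ (proj₁ a <ᵇ suc r) ∧ (suc r ≤ᵇ proj₂ a)) + ind (spans p r a)
                      ≡ ind (spans r r a)
      pointwise (a₁ , a₂) with r <ᵇ a₂
      ... | false rewrite ∧-zeroʳ (a₁ <ᵇ suc r) | ∧-zeroʳ (p <ᵇ a₁) | ∧-zeroʳ (a₁ ≤ᵇ p) | ∧-zeroʳ (a₁ ≤ᵇ r) = refl
      ... | true with ≤-<-connex a₁ p | ≤-<-connex a₁ r
      ...   | inj₁ a₁≤p | _ rewrite ≤ᵇ-false (s≤s a₁≤p) | ≤ᵇ-true a₁≤p | ≤ᵇ-true (≤-trans a₁≤p p≤r) = refl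
      ...   | inj₂ p<a₁ | inj₁ a₁≤r rewrite ≤ᵇ-true p<a₁ | ≤ᵇ-false p<a₁ | ≤ᵇ-true (s≤s a₁≤r) | ≤ᵇ-true a₁≤r = refl
      ...   | inj₂ p<a₁ | inj₂ r<a₁ rewrite ≤ᵇ-true p<a₁ | ≤ᵇ-false p<a₁ | ≤ᵇ-false (s≤s r<a₁) | ≤ᵇ-false r<a₁ = refl

    -- The two sizes add up to (p - 2d - M) + (p - 2e - M) = 2 (X - d - e), so the halving is exact;
    -- `X` then splits into its two halves.
    mA≡ : mA n π p ≡ (⌈ X /2⌉ ∸ d) + (⌊ X /2⌋ ∸ e)
    mA≡ = trans (cong ⌊_/2⌋ twice) (sym (n≡⌊n+n/2⌋ _))
      where
      d≤⌈X/2⌉ : d ≤ ⌈ X /2⌉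
      d≤⌈X/2⌉ = subst (_≤ ⌈ X /2⌉) (sym (n≡⌈n+n/2⌉ d)) (⌈n/2⌉-mono 2d≤X)

      e≤⌊X/2⌋ : e ≤ ⌊ X /2⌋
      e≤⌊X/2⌋ = subst (_≤ ⌊ X /2⌋) (sym (n≡⌊n+n/2⌋ e)) (⌊n/2⌋-mono 2e≤X)

      solution : ∀ l r M d e u v {A B X p} → l + M + (d + d) ≡ p → r + M + (e + e) ≡ p → M + X ≡ p →
                 B + A ≡ X → u + d ≡ A → v + e ≡ B → l + r ≡ (u + v) + (u + v)
      solution l r M d e u v L R refl refl refl refl =
        +-cancelʳ-≡ (M + M + (d + d) + (e + e)) (l + r) ((u + v) + (u + v))
          (trans (shuffle₁ l r M d e) (trans (cong₂ _+_ L R) (shuffle₂ u v M d e)))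
        where
        shuffle₁ : ∀ l r M d e → l + r + (M + M + (d + d) + (e + e)) ≡ l + M + (d + d) + (r + M + (e + e))
        shuffle₁ l r M d e = solve (l ∷ r ∷ M ∷ d ∷ e ∷ [])
        shuffle₂ : ∀ u v M d e → M + (v + e + (u + d)) + (M + (v + e + (u + d)))
                               ≡ (u + v) + (u + v) + (M + M + (d + d) + (e + e))
        shuffle₂ u v M d e = solve (u ∷ v ∷ M ∷ d ∷ e ∷ [])

      twice : length (ALset n π p) + length (ARset n π p)
            ≡ (⌈ X /2⌉ ∸ d) + (⌊ X /2⌋ ∸ e) + ((⌈ X /2⌉ ∸ d) + (⌊ X /2⌋ ∸ e))
      twice = solution (length (ALset n π p)) (length (ARset n π p)) M d e (⌈ X /2⌉ ∸ d) (⌊ X /2⌋ ∸ e)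
        (trans (cong (_+ (d + d)) AL+M) height-p) (trans (cong (_+ (e + e)) AR+M) height-r)
        M+X (⌊n/2⌋+⌈n/2⌉≡n X) (m∸n+n≡m d≤⌈X/2⌉) (m∸n+n≡m e≤⌊X/2⌋)

theorem3p1 : (n : ℕ) (π : List Arch) → IsNCMatching n π →
    (p : ℕ) → 1 ≤ p → p ≤ n ∸ 1 → mA n π p ≡ mB n π p
theorem3p1 n π nc p 1≤p p≤n∸1 = trans mA≡ (sym mB≡)
  where
  p≤n : p ≤ n
  p≤n = ≤-trans p≤n∸1 (m∸n≤m n 1)
  open Matching n π nc
  open At p≤n (m+[n∸m]≡n {p} {2 * n} (≤-trans p≤n (m≤m+n n (n + 0))))
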